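{- There exist constants $C > 0$ and $\delta > 0$ such that the following holds. If $r, s \in \mathbb{N}$ with $1 \le s \le r - C\log r$, and $\varepsilon = (r-s)/r$, then $$R_{r,s}(k) \ge \exp\bigg( \frac{\delta k (r-s)^2}{r} \bigg)$$ for every integer $k \ge (C/\varepsilon)\log r$.
   Context: For positive integers $r > s \ge 1$ and $k$, the set-colouring Ramsey number $R_{r,s}(k)$ is the least $n \in \mathbb{N}$ such that every colouring $\chi \colon E(K_n) \to \binom{[r]}{s}$ (each edge of the complete graph $K_n$ is assigned a set of exactly $s$ colours from $[r] = \{1,\dots,r\}$) contains a monochromatic clique of size $k$, that is, a set $S \subset V(K_n)$ with $|S| = k$ and a colour $i \in [r]$ such that $i \in \chi(e)$ for every $e \in \binom{S}{2}$. -}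

module Defs where

open import Data.Nat using (ℕ)
open import Data.Fin using (Fin)
open import Data.Fin.Subset using (Subset; _∈_; ∣_∣)
open import Data.Product using (Σ; ∃; _×_; _,_)
open import Relation.Binary.PropositionalEquality using (_≡_; _≢_)

-- A colouring χ : E(K_n) → ([r] choose s).  Edges are unordered pairs,
-- represented by a symmetric function on ordered pairs of distinct vertices
-- (the diagonal values are irrelevant).  Colours are Fin r.
SetColouring : (r s n : ℕ) → Set
SetColouring r s n =
  Σ (Fin n → Fin n → Subset r) λ χ →
    (∀ i j → χ i j ≡ χ j i) × (∀ i j → i ≢ j → ∣ χ i j ∣ ≡ s)

HasMonoClique : ∀ {r s n} → ℕ → SetColouring r s n → Set
HasMonoClique {r} {s} {n} k (χ , _) =
  Σ (Subset n) λ S → Σ (Fin r) λ c →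
    (∣ S ∣ ≡ k) × (∀ i j → i ∈ S → j ∈ S → i ≢ j → c ∈ χ i j)

-- "n has the Ramsey property": every colouring of E(K_n) has a
-- monochromatic K_k.  R_{r,s}(k) is the least such n.
RamseyProperty : (r s k n : ℕ) → Set
RamseyProperty r s k n = (χ : SetColouring r s n) → HasMonoClique k χ

{-# OPTIONS --safe #-}
module Submission where

-- Write d = r − s.  For each colour j take a random map φ_j from the n vertices to m = 2^(c k d/r) points and,
-- on these points, a random graph H_j of non-edge density about d/r; a pair uv misses the colour j if φ_j u and
-- φ_j v coincide or are not adjacent in H_j.  For n = 2^(c′ k d²/r) no two vertices coincide in more than a small
-- multiple of d colours, but some pairs miss more than d colours.  These bad pairs are given every colour in which
-- their images do not coincide.  If S is a clique of size k in colour c, then φ_c is injective on S, so S contains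
-- of the order of k² d/r pairs that are non-edges of H_c, since m is small enough for a union bound over the subsets
-- of H_c.  All these pairs are bad.  A random k-tuple has few collisions, so at least half of S collides with the
-- rest of S in only a small multiple of d colours; on that half the badness of distinct pairs is witnessed by
-- distinct edges of the H_j with j ≠ c, hence is independent, with probability 2^(−Ω(d)) each.  Altogether S occurs
-- with probability 2^(−Ω(k² d²/r)), which beats the n^k choices of S.

open import Data.Bool using (Bool; true; false; if_then_else_; _∨_; _∧_; not)
open import Data.Bool.Properties using (∨-zeroʳ; ∧-zeroʳ; ∧-conicalˡ)
open import Data.Fin as Fin using (Fin; zero; suc; combine)
import Data.Fin.Properties as Fin
open import Data.Fin.Subset as Subset using (Subset; ∣_∣) renaming (_∈_ to _∈ₛ_)
import Data.Fin.Subset.Properties as Subset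
open import Data.List as List
  using (List; []; _∷_; length; map; filter; _++_; allFin; cartesianProductWith; cartesianProduct)
import Data.List.Properties as List
open import Data.List.Membership.Propositional using (_∈_)
open import Data.List.Membership.Propositional.Properties
  using (∈-filter⁺; ∈-cartesianProductWith⁺; ∈-cartesianProduct⁺; ∈-allFin)
open import Data.List.Relation.Unary.All as All using (All; []; _∷_)
import Data.List.Relation.Unary.All.Properties as All
open import Data.List.Relation.Unary.AllPairs as AllPairs using (AllPairs; []; _∷_)
import Data.List.Relation.Unary.AllPairs.Properties as AllPairs
open import Data.List.Relation.Unary.Any using (here; there)
import Data.List.Relation.Unary.Unique.Propositional as List
open import Data.List.Relation.Unary.Unique.Propositional.Properties using (allFin⁺)
open import Data.Nat hiding (_≟_)
open import Data.Nat.DivMod using (m≡m%n+[m/n]*n; m%n<n; m/n*n≤m)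
open import Data.Nat.ListAction using () renaming (sum to List∑; product to List∏)
open import Data.Nat.Properties
open import Data.Nat.Tactic.RingSolver using (solve-∀)
open import Data.Product using (Σ; ∃; _×_; _,_; proj₁; proj₂)
open import Data.Sum using (_⊎_; inj₁; inj₂)
open import Data.Unit using (tt)
open import Data.Vec as Vec using (Vec; []; _∷_; lookup; _[_]≔_)
import Data.Vec.Membership.Propositional as Vec
open import Data.Vec.Membership.Propositional.Properties using (∈-lookup; fromAny)
open import Data.Vec.Properties
  using (lookup∘update; lookup∘update′; tabulate-cong; lookup∘tabulate; []=⇒lookup)
open import Data.Vec.Relation.Unary.All as VecAll using ([]; _∷_)
import Data.Vec.Relation.Unary.All.Properties as VecAll
open import Data.Vec.Relation.Unary.AllPairs using ([]; _∷_; allPairs?)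
open import Data.Vec.Relation.Unary.Any as VecAny using (here; there)
import Data.Vec.Relation.Unary.Any.Properties as VecAny
open import Data.Vec.Relation.Unary.Unique.Propositional using (Unique)
import Data.Vec.Relation.Unary.Unique.Propositional.Properties as Unique
open import Function using (_∘_; id)
open import Relation.Binary.PropositionalEquality
open import Relation.Nullary
open import Relation.Nullary.Decidable using (dec-true; dec-false; decidable-stable)
open import Relation.Unary using (Decidable)

open import Algebra.Properties.Semiring.Sum +-*-semiring
  using (sum; sum-cong-≗; ∑-distrib-+; ∑-comm; *-distribˡ-sum; *-distribʳ-sum)

open import Defs

private variable
  X Y Z : Set
  Q N n r m p : ℕ

-- Averages over uniformly random vectors

sum-mono : ∀ {n} {f g : Fin n → ℕ} → (∀ i → f i ≤ g i) → sum f ≤ sum g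
sum-mono {zero} f≤g = z≤n
sum-mono {suc n} f≤g = +-mono-≤ (f≤g zero) (sum-mono (f≤g ∘ suc))

sum-const : ∀ n c → sum {n} (λ _ → c) ≡ n * c
sum-const zero c = refl
sum-const (suc n) c = cong (c +_) (sum-const n c)

sum-<-const : ∀ n (f : Fin n → ℕ) c → sum f < n * c → ∃ λ i → f i < c
sum-<-const (suc n) f c lt with f zero <? c
... | yes p = zero , p
... | no ¬p with sum-<-const n (f ∘ suc) c (+-cancelˡ-< c _ _ (≤-<-trans (+-monoˡ-≤ _ (≮⇒≥ ¬p)) lt))
...   | i , q = suc i , q

-- Q^N times the expectation of f at a uniformly random vector.
E : (Vec (Fin Q) N → ℕ) → ℕ
E {N = zero} f = f []
E {N = suc N} f = sum λ x → E λ v → f (x ∷ v)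

E-mono : {f g : Vec (Fin Q) N → ℕ} → (∀ v → f v ≤ g v) → E f ≤ E g
E-mono {N = zero} f≤g = f≤g []
E-mono {N = suc N} f≤g = sum-mono λ x → E-mono λ v → f≤g (x ∷ v)

E-cong : {f g : Vec (Fin Q) N → ℕ} → (∀ v → f v ≡ g v) → E f ≡ E g
E-cong f≡g = ≤-antisym (E-mono λ v → ≤-reflexive (f≡g v)) (E-mono λ v → ≤-reflexive (sym (f≡g v)))

E-+ : (f g : Vec (Fin Q) N → ℕ) → E (λ v → f v + g v) ≡ E f + E g
E-+ {N = zero} f g = refl
E-+ {N = suc N} f g = trans (sum-cong-≗ λ x → E-+ (λ v → f (x ∷ v)) _) (∑-distrib-+ (λ x → E λ v → f (x ∷ v)) _)

E-* : ∀ c (f : Vec (Fin Q) N → ℕ) → E (λ v → c * f v) ≡ c * E f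
E-* {N = zero} c f = refl
E-* {N = suc N} c f = trans (sum-cong-≗ λ x → E-* c (λ v → f (x ∷ v))) (sym (*-distribˡ-sum c λ x → E λ v → f (x ∷ v)))

E-const : ∀ c → E {Q} {N} (λ _ → c) ≡ Q ^ N * c
E-const {Q} {zero} c = sym (+-identityʳ c)
E-const {Q} {suc N} c = trans (sum-cong-≗ {Q} λ _ → E-const {Q} {N} c) (trans (sum-const Q _) (sym (*-assoc Q (Q ^ N) c)))

E-swap-sum : ∀ {n} (f : Fin n → Vec (Fin Q) N → ℕ) → sum (λ i → E (f i)) ≡ E λ v → sum λ i → f i v
E-swap-sum {N = zero} f = refl
E-swap-sum {N = suc N} f = trans (∑-comm λ i x → E λ v → f i (x ∷ v)) (sum-cong-≗ λ x → E-swap-sum λ i v → f i (x ∷ v))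

E-sumList : (f : X → Vec (Fin Q) N → ℕ) (xs : List X) →
  E (λ v → List∑ (map (λ x → f x v) xs)) ≡ List∑ (map (λ x → E (f x)) xs)
E-sumList {Q = Q} {N} f [] = trans (E-const {Q} {N} 0) (*-zeroʳ (Q ^ N))
E-sumList f (x ∷ xs) = trans (E-+ (f x) _) (cong (E (f x) +_) (E-sumList f xs))

-- The coordinates are fixed one after the other, each so that the conditional expectation stays
-- below `θ`.
E-<-const : (f : Vec (Fin Q) N → ℕ) (θ : ℕ) → E f < Q ^ N * θ → ∃ λ v → f v < θ
E-<-const {N = zero} f θ lt = [] , subst (f [] <_) (+-identityʳ θ) lt
E-<-const {Q = Q} {N = suc N} f θ lt with sum-<-const Q _ (Q ^ N * θ) (subst (E f <_) (*-assoc Q (Q ^ N) θ) lt)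
... | x , lt′ with E-<-const (λ v → f (x ∷ v)) θ lt′
...   | v , q = x ∷ v , q

E-resample : (κ : Fin N) {f g : Vec (Fin Q) N → ℕ} →
  (∀ v → sum (λ x → f (v [ κ ]≔ x)) ≤ sum (λ x → g (v [ κ ]≔ x))) → E f ≤ E g
E-resample {Q = Q} zero {f} {g} h with Q
... | zero = z≤n
... | suc _ = begin
  sum (λ x → E λ v → f (x ∷ v))  ≡⟨ E-swap-sum (λ x v → f (x ∷ v)) ⟩
  -- The head `zero` is an arbitrary value that the update overwrites; only its existence matters,
  -- so `Q = 0` is split off.
  E (λ v → sum λ x → f (x ∷ v))  ≤⟨ E-mono (λ v → h (zero ∷ v)) ⟩
  E (λ v → sum λ x → g (x ∷ v))  ≡⟨ sym (E-swap-sum (λ x v → g (x ∷ v))) ⟩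
  sum (λ x → E λ v → g (x ∷ v))  ∎
  where open ≤-Reasoning
E-resample (suc κ) h = sum-mono λ y → E-resample κ λ v → h (y ∷ v)

Indep : Fin N → (Vec (Fin Q) N → ℕ) → Set
Indep κ h = ∀ v x → h (v [ κ ]≔ x) ≡ h v

-- Since `h` ignores the coordinate `κ`, it factors out of the average over that coordinate, where
-- `g` has mean at most `c / q`. Denominators are cleared so that everything stays in `ℕ`.
E-peel : (κ : Fin N) {g h : Vec (Fin Q) N → ℕ} (q c : ℕ) → Indep κ h →
  (∀ v → q * sum (λ x → g (v [ κ ]≔ x)) ≤ c * Q) → q * E (λ v → g v * h v) ≤ c * E h
E-peel {Q = Q} κ {g} {h} q c ind bound = begin
  q * E (λ v → g v * h v)    ≡⟨ sym (E-* q λ v → g v * h v) ⟩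
  E (λ v → q * (g v * h v))  ≤⟨ E-resample κ pointwise ⟩
  E (λ v → c * h v)          ≡⟨ E-* c h ⟩
  c * E h                    ∎
  where
  open ≤-Reasoning
  pointwise : ∀ v → sum (λ x → q * (g (v [ κ ]≔ x) * h (v [ κ ]≔ x))) ≤ sum (λ x → c * h (v [ κ ]≔ x))
  pointwise v = begin
    sum (λ x → q * (g (v [ κ ]≔ x) * h (v [ κ ]≔ x)))
      ≡⟨ sym (*-distribˡ-sum q λ x → g (v [ κ ]≔ x) * h (v [ κ ]≔ x)) ⟩
    q * sum (λ x → g (v [ κ ]≔ x) * h (v [ κ ]≔ x))
      ≡⟨ cong (q *_) (sum-cong-≗ λ x → cong (g (v [ κ ]≔ x) *_) (ind v x)) ⟩
    q * sum (λ x → g (v [ κ ]≔ x) * h v)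
      ≡⟨ cong (q *_) (sym (*-distribʳ-sum (h v) λ x → g (v [ κ ]≔ x))) ⟩
    q * (sum (λ x → g (v [ κ ]≔ x)) * h v)
      ≡⟨ sym (*-assoc q _ (h v)) ⟩
    q * sum (λ x → g (v [ κ ]≔ x)) * h v
      ≤⟨ *-monoˡ-≤ (h v) (bound v) ⟩
    c * Q * h v
      ≡⟨ shuffle c Q (h v) ⟩
    Q * (c * h v)
      ≡⟨ sym (sum-const Q (c * h v)) ⟩
    sum {Q} (λ _ → c * h v)
      ≡⟨ sum-cong-≗ (λ x → cong (c *_) (sym (ind v x))) ⟩
    sum (λ x → c * h (v [ κ ]≔ x)) ∎
    where
    shuffle : ∀ a b d → a * b * d ≡ b * (a * d)
    shuffle = solve-∀

-- Products of independent factors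

Π : List X → (X → ℕ) → ℕ
Π xs f = List∏ (map f xs)

Indep-* : {κ : Fin N} {f g : Vec (Fin Q) N → ℕ} → Indep κ f → Indep κ g → Indep κ (λ v → f v * g v)
Indep-* f g v x = cong₂ _*_ (f v x) (g v x)

Indep-Π : {κ : Fin N} (w : X → Vec (Fin Q) N → ℕ) (xs : List X) →
  All (λ x → Indep κ (w x)) xs → Indep κ (λ v → Π xs λ x → w x v)
Indep-Π w [] [] v x = refl
Indep-Π w (_ ∷ xs) (p ∷ ps) v x = cong₂ _*_ (p v x) (Indep-Π w xs ps v x)

-- κs x collects the coordinates that have to be averaged out in order to bound the factor w x.
E-Π-peel : (w : X → Vec (Fin Q) N → ℕ) (κs : X → Fin N → Set) (q c : ℕ) →
  (∀ x h → (∀ κ → κs x κ → Indep κ h) → q * E (λ v → w x v * h v) ≤ c * E h) →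
  (xs : List X) → AllPairs (λ x y → ∀ κ → κs x κ → Indep κ (w y)) xs →
  (h : Vec (Fin Q) N → ℕ) → (∀ x κ → κs x κ → Indep κ h) →
  q ^ length xs * E (λ v → Π xs (λ x → w x v) * h v) ≤ c ^ length xs * E h
E-Π-peel w κs q c step [] [] h ind = ≤-reflexive (cong (1 *_) (E-cong λ v → *-identityˡ (h v)))
E-Π-peel w κs q c step (x ∷ xs) (p ∷ ps) h ind = begin
  q * q ^ l * E (λ v → w x v * P v * h v)    ≡⟨ shuffle q (q ^ l) _ ⟩
  q ^ l * (q * E (λ v → w x v * P v * h v))
    ≡⟨ cong (λ e → q ^ l * (q * e)) (E-cong λ v → *-assoc (w x v) (P v) (h v)) ⟩
  q ^ l * (q * E (λ v → w x v * (P v * h v)))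
    ≤⟨ *-monoʳ-≤ (q ^ l) (step x _ λ κ k → Indep-* (Indep-Π w xs (All.map (λ f → f κ k) p)) (ind x κ k)) ⟩
  q ^ l * (c * E (λ v → P v * h v))          ≡⟨ sym (*-assoc (q ^ l) c _) ⟩
  q ^ l * c * E (λ v → P v * h v)            ≡⟨ cong (_* E (λ v → P v * h v)) (*-comm (q ^ l) c) ⟩
  c * q ^ l * E (λ v → P v * h v)            ≡⟨ *-assoc c (q ^ l) _ ⟩
  c * (q ^ l * E (λ v → P v * h v))          ≤⟨ *-monoʳ-≤ c (E-Π-peel w κs q c step xs ps h ind) ⟩
  c * (c ^ l * E h)                          ≡⟨ sym (*-assoc c (c ^ l) _) ⟩
  c * c ^ l * E h                            ∎
  where
  open ≤-Reasoning
  l = length xs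
  P = λ v → Π xs λ y → w y v
  shuffle : ∀ a b d → a * b * d ≡ b * (a * d)
  shuffle = solve-∀

-- Markov's inequality and the union bound

sum-map-≤ : (f : X → ℕ) (q M : ℕ) (xs : List X) → All (λ x → q * f x ≤ M) xs →
  q * List∑ (map f xs) ≤ length xs * M
sum-map-≤ f q M [] [] = ≤-reflexive (*-zeroʳ q)
sum-map-≤ f q M (x ∷ xs) (p ∷ ps) = begin
  q * (f x + List∑ (map f xs))      ≡⟨ *-distribˡ-+ q (f x) _ ⟩
  q * f x + q * List∑ (map f xs)    ≤⟨ +-mono-≤ p (sum-map-≤ f q M xs ps) ⟩
  M + length xs * M                    ∎
  where open ≤-Reasoning

∈⇒≤sum : (f : X → ℕ) {x : X} {xs : List X} → x ∈ xs → f x ≤ List∑ (map f xs)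
∈⇒≤sum f (here refl) = m≤m+n _ _
∈⇒≤sum f (there i) = ≤-trans (∈⇒≤sum f i) (m≤n+m _ _)

-- By Markov's inequality, the events θ ≤ w x with x in xs and P x have total probability at most 1/4.
record Rare {X : Set} (P : X → Set) (xs : List X) (w : X → Vec (Fin Q) N → ℕ) (θ : ℕ) : Set where
  field
    dec : Decidable P
    q M : ℕ
    q-pos : 1 ≤ q
    θ-pos : 1 ≤ θ
    mean : ∀ x → P x → q * E (w x) ≤ M
    small : 4 * (length xs * M) ≤ q * θ * Q ^ N

module _ {Q N : ℕ} {X : Set} {P : X → Set} {xs : List X} {w : X → Vec (Fin Q) N → ℕ} {θ : ℕ} (R : Rare P xs w θ) where
  open Rare R

  total : Vec (Fin Q) N → ℕ
  total v = List∑ (map (λ x → w x v) (filter dec xs))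

  E-total : 4 * E total ≤ θ * Q ^ N
  E-total = *-cancelˡ-≤ q {{>-nonZero q-pos}} (begin
    q * (4 * E total)                                         ≡⟨ shuffle q 4 _ ⟩
    4 * (q * E total)
      ≡⟨ cong (λ e → 4 * (q * e)) (E-sumList w (filter dec xs)) ⟩
    4 * (q * List∑ (map (λ x → E (w x)) (filter dec xs)))
      ≤⟨ *-monoʳ-≤ 4 (sum-map-≤ (λ x → E (w x)) q M (filter dec xs) (All.map (mean _) (All.all-filter dec xs))) ⟩
    4 * (length (filter dec xs) * M)
      ≤⟨ *-monoʳ-≤ 4 (*-monoˡ-≤ M (List.length-filter dec xs)) ⟩
    4 * (length xs * M)                                       ≤⟨ small ⟩
    q * θ * Q ^ N                                             ≡⟨ *-assoc q θ _ ⟩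
    q * (θ * Q ^ N)                                           ∎)
    where
    open ≤-Reasoning
    shuffle : ∀ a b d → a * (b * d) ≡ b * (a * d)
    shuffle = solve-∀

  below-total : ∀ {v} → total v < θ → ∀ x → x ∈ xs → P x → w x v < θ
  below-total lt x x∈ p = ≤-<-trans (∈⇒≤sum (λ x → w x _) (∈-filter⁺ dec x∈ p)) lt

-- Each total is weighted by the threshold of the other. The sum has mean at most half of `θ * θ′`,
-- and wherever it is below `θ * θ′` both totals are below their thresholds.
avoid-both : {Y : Set} {P : X → Set} {xs : List X} {w : X → Vec (Fin Q) N → ℕ} {θ : ℕ}
  {P′ : Y → Set} {ys : List Y} {w′ : Y → Vec (Fin Q) N → ℕ} {θ′ : ℕ} → 1 ≤ Q →
  Rare P xs w θ → Rare P′ ys w′ θ′ →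
  ∃ λ v → (∀ x → x ∈ xs → P x → w x v < θ) × (∀ y → y ∈ ys → P′ y → w′ y v < θ′)
avoid-both {Q = Q} {N = N} {θ = θ} {θ′ = θ′} Q≥1 R R′ =
  let v , lt = E-<-const f (θ * θ′) f-mean in
  v , below-total R (*-cancelˡ-< θ′ _ _ (≤-<-trans (m≤m+n _ _) (subst (f v <_) (*-comm θ θ′) lt)))
    , below-total R′ (*-cancelˡ-< θ _ _ (≤-<-trans (m≤n+m _ _) lt))
  where
  open ≤-Reasoning
  f : Vec (Fin Q) N → ℕ
  f v = θ′ * total R v + θ * total R′ v
  B = Q ^ N * (θ * θ′)
  instance
    _ = >-nonZero Q≥1
    _ = >-nonZero (Rare.θ-pos R)
    _ = >-nonZero (Rare.θ-pos R′)
    _ = m^n≢0 Q N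
    _ = m*n≢0 θ θ′
    _ = m*n≢0 (Q ^ N) (θ * θ′)
  shuffle : ∀ a b c d → 4 * (a * c + b * d) ≡ a * (4 * c) + b * (4 * d)
  shuffle = solve-∀
  shuffle′ : ∀ a b c → a * (b * c) + b * (a * c) ≡ 2 * (c * (b * a))
  shuffle′ = solve-∀
  4f≤2B : 4 * E f ≤ 2 * B
  4f≤2B = begin
    4 * E f
      ≡⟨ cong (4 *_) (trans (E-+ (λ v → θ′ * total R v) λ v → θ * total R′ v) (cong₂ _+_ (E-* θ′ (total R)) (E-* θ (total R′)))) ⟩
    4 * (θ′ * E (total R) + θ * E (total R′))        ≡⟨ shuffle θ′ θ _ _ ⟩
    θ′ * (4 * E (total R)) + θ * (4 * E (total R′))
      ≤⟨ +-mono-≤ (*-monoʳ-≤ θ′ (E-total R)) (*-monoʳ-≤ θ (E-total R′)) ⟩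
    θ′ * (θ * Q ^ N) + θ * (θ′ * Q ^ N)              ≡⟨ shuffle′ θ′ θ (Q ^ N) ⟩
    2 * B                                            ∎
  f-mean : E f < B
  f-mean = *-cancelˡ-< 4 _ _ (≤-<-trans 4f≤2B (*-monoˡ-< B {2} {4} (s≤s (s≤s (s≤s z≤n)))))

-- Enumerating tuples, counting, and unordered pairs

length-cartesianProductWith : (f : X → Y → Z) (xs : List X) (ys : List Y) →
  length (cartesianProductWith f xs ys) ≡ length xs * length ys
length-cartesianProductWith f [] ys = refl
length-cartesianProductWith f (x ∷ xs) ys = trans (List.length-++ (map (f x) ys))
  (cong₂ _+_ (List.length-map (f x) ys) (length-cartesianProductWith f xs ys))

vecs : ∀ n k → List (Vec (Fin n) k)
vecs n zero = [] ∷ []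
vecs n (suc k) = cartesianProductWith _∷_ (allFin n) (vecs n k)

length-allFin : ∀ n → length (allFin n) ≡ n
length-allFin n = List.length-tabulate {n = n} id

length-vecs : ∀ n k → length (vecs n k) ≡ n ^ k
length-vecs n zero = refl
length-vecs n (suc k) = trans (length-cartesianProductWith _∷_ (allFin n) (vecs n k)) (cong₂ _*_ (length-allFin n) (length-vecs n k))

∈-vecs : ∀ {n k} (v : Vec (Fin n) k) → v ∈ vecs n k
∈-vecs [] = here refl
∈-vecs (x ∷ v) = ∈-cartesianProductWith⁺ _∷_ (∈-allFin x) (∈-vecs v)

length-colours×vecs : ∀ r n k → length (cartesianProduct (allFin r) (vecs n k)) ≡ r * n ^ k
length-colours×vecs r n k = trans (length-cartesianProductWith _,_ (allFin r) (vecs n k)) (cong₂ _*_ (length-allFin r) (length-vecs n k))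

count : (X → Bool) → List X → ℕ
count p xs = List∑ (map (λ x → if p x then 1 else 0) xs)

∣tabulate∣ : ∀ {n} (p : Fin n → Bool) → ∣ Vec.tabulate p ∣ ≡ count p (allFin n)
∣tabulate∣ p = trans (go p) (cong List∑ (sym (List.map-tabulate id (λ i → if p i then 1 else 0))))
  where
  go : ∀ {n} (p : Fin n → Bool) → ∣ Vec.tabulate p ∣ ≡ List∑ (List.tabulate λ i → if p i then 1 else 0)
  go {zero} p = refl
  go {suc n} p with p zero
  ... | true = cong suc (go (p ∘ suc))
  ... | false = go (p ∘ suc)

count-mono : {p q : X → Bool} (xs : List X) → (∀ x → p x ≡ true → q x ≡ true) → count p xs ≤ count q xs
count-mono [] p⇒q = z≤n
count-mono {p = p} {q} (x ∷ xs) p⇒q with p x in eq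
... | false = ≤-trans (count-mono xs p⇒q) (m≤n+m _ _)
... | true rewrite p⇒q x eq = s≤s (count-mono xs p⇒q)

count-∨ : (p q : X → Bool) (xs : List X) → count (λ x → p x ∨ q x) xs ≤ count p xs + count q xs
count-∨ p q [] = z≤n
count-∨ p q (x ∷ xs) with p x
... | true = s≤s (≤-trans (count-∨ p q xs) (+-monoʳ-≤ (count p xs) (m≤n+m _ _)))
... | false with q x
...   | true = ≤-trans (s≤s (count-∨ p q xs)) (≤-reflexive (sym (+-suc (count p xs) _)))
...   | false = count-∨ p q xs

count-not : (p : X → Bool) (xs : List X) → count p xs + count (not ∘ p) xs ≡ length xs
count-not p [] = refl
count-not p (x ∷ xs) with p x
... | true = cong suc (count-not p xs)
... | false = trans (+-suc (count p xs) _) (cong suc (count-not p xs))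

Π-if : ∀ y (p : X → Bool) (xs : List X) → Π xs (λ x → if p x then y else 1) ≡ y ^ count p xs
Π-if y p [] = refl
Π-if y p (x ∷ xs) with p x
... | true = cong (y *_) (Π-if y p xs)
... | false = trans (*-identityˡ _) (Π-if y p xs)

-- With `y = 2` this turns an upper bound on 2 to the number of edges into a lower bound on the
-- number of non-edges.
Π-if-not : ∀ y (p : X → Bool) (xs : List X) →
  Π xs (λ x → if p x then 1 else y) * y ^ count p xs ≡ y ^ length xs
Π-if-not y p [] = refl
Π-if-not y p (x ∷ xs) with p x
... | false = trans (*-assoc y _ _) (cong (y *_) (Π-if-not y p xs))
... | true = trans (shuffle (Π xs _) y (y ^ count p xs)) (cong (y *_) (Π-if-not y p xs))
  where
  shuffle : ∀ a b c → (1 * a) * (b * c) ≡ b * (a * c)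
  shuffle = solve-∀

-- Serves for the pairs of a clique, where each pair weighs at least `2 ^ d` and each non-edge at
-- least `2 ^ (d + d)`.
Π-lower : ∀ d (p : X → Bool) (w : X → ℕ) (xs : List X) →
  All (λ x → 2 ^ (d + (if p x then d else 0)) ≤ w x) xs → 2 ^ (d * length xs + d * count p xs) ≤ Π xs w
Π-lower d p w [] [] = ≤-reflexive (cong (2 ^_) (cong₂ _+_ (*-zeroʳ d) (*-zeroʳ d)))
Π-lower d p w (x ∷ xs) (b ∷ bs) = begin
  2 ^ (d * suc (length xs) + d * (bit + count p xs))
    ≡⟨ cong (2 ^_) (shuffle d (length xs) bit (count p xs)) ⟩
  2 ^ ((d + d * bit) + (d * length xs + d * count p xs))
    ≡⟨ cong (λ e → 2 ^ ((d + e) + _)) d*bit ⟩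
  2 ^ ((d + (if p x then d else 0)) + (d * length xs + d * count p xs))
    ≡⟨ ^-distribˡ-+-* 2 (d + (if p x then d else 0)) _ ⟩
  2 ^ (d + (if p x then d else 0)) * 2 ^ (d * length xs + d * count p xs)
    ≤⟨ *-mono-≤ b (Π-lower d p w xs bs) ⟩
  w x * Π xs w ∎
  where
  open ≤-Reasoning
  bit = if p x then 1 else 0
  shuffle : ∀ d l b c → d * (1 + l) + d * (b + c) ≡ (d + d * b) + (d * l + d * c)
  shuffle = solve-∀
  d*bit : d * bit ≡ (if p x then d else 0)
  d*bit with p x
  ... | true = *-identityʳ d
  ... | false = *-zeroʳ d

pairs : ∀ k → List (Fin k × Fin k)
pairs zero = []
pairs (suc k) = map (λ b → zero , suc b) (allFin k) ++ map (λ (a , b) → suc a , suc b) (pairs k)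

2*length-pairs : ∀ k → 2 * length (pairs k) + k ≡ k * k
2*length-pairs zero = refl
2*length-pairs (suc k) = begin
  2 * length (pairs (suc k)) + suc k        ≡⟨ cong (λ l → 2 * l + suc k) len ⟩
  2 * (k + length (pairs k)) + suc k        ≡⟨ shuffle k (length (pairs k)) ⟩
  (2 * length (pairs k) + k) + (2 * k + 1)  ≡⟨ cong (_+ (2 * k + 1)) (2*length-pairs k) ⟩
  k * k + (2 * k + 1)                       ≡⟨ shuffle′ k ⟩
  suc k * suc k                             ∎
  where
  open ≡-Reasoning
  len : length (pairs (suc k)) ≡ k + length (pairs k)
  len = trans (List.length-++ (map _ (allFin k))) (cong₂ _+_ (trans (List.length-map _ (allFin k)) (length-allFin k)) (List.length-map _ (pairs k)))
  shuffle : ∀ k l → 2 * (k + l) + (1 + k) ≡ (2 * l + k) + (2 * k + 1)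
  shuffle = solve-∀
  shuffle′ : ∀ k → k * k + (2 * k + 1) ≡ (1 + k) * (1 + k)
  shuffle′ = solve-∀

SamePair : X × X → X × X → Set
SamePair (a , b) (c , d) = (a ≡ c × b ≡ d) ⊎ (a ≡ d × b ≡ c)

pairs-ordered : ∀ k → All (λ (a , b) → a ≢ b) (pairs k)
pairs-ordered zero = []
pairs-ordered (suc k) = All.++⁺ (All.map⁺ (All.universal (λ _ ()) (allFin k)))
  (All.map⁺ (All.map (λ a≢b eq → a≢b (Fin.suc-injective eq)) (pairs-ordered k)))

pairs-distinct : ∀ k → AllPairs (λ e f → ¬ SamePair e f) (pairs k)
pairs-distinct zero = []
pairs-distinct (suc k) = AllPairs.++⁺
  (AllPairs.map⁺ (AllPairs.tabulate⁺ λ i≢j → λ { (inj₁ (_ , eq)) → i≢j (Fin.suc-injective eq) ; (inj₂ ()) }))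
  (AllPairs.map⁺ (AllPairs.map (λ ne → λ
    { (inj₁ (p , q)) → ne (inj₁ (Fin.suc-injective p , Fin.suc-injective q))
    ; (inj₂ (p , q)) → ne (inj₂ (Fin.suc-injective p , Fin.suc-injective q)) }) (pairs-distinct k)))
  (All.map⁺ (All.universal (λ _ → All.map⁺ (All.universal (λ _ → λ { (inj₁ ()) ; (inj₂ ()) }) (pairs k))) (allFin k)))

-- Elementary bounds on powers

-- (1 + 1/Q)^j ≤ Q/(Q − j)
suc^*≤ : ∀ j t Q → j + t ≡ Q → suc Q ^ j * t ≤ Q ^ j * Q
suc^*≤ zero t Q refl = ≤-refl
suc^*≤ (suc j) t Q eq = begin
  suc Q * suc Q ^ j * t   ≡⟨ shuffle (suc Q) (suc Q ^ j) t ⟩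
  suc Q ^ j * (t + Q * t)
    ≤⟨ *-monoʳ-≤ (suc Q ^ j) (+-monoˡ-≤ (Q * t) (subst (t ≤_) eq (m≤n+m t (suc j)))) ⟩
  suc Q ^ j * (Q + Q * t) ≡⟨ shuffle′ (suc Q ^ j) Q t ⟩
  Q * (suc Q ^ j * suc t) ≤⟨ *-monoʳ-≤ Q (suc^*≤ j (suc t) Q (trans (+-suc j t) eq)) ⟩
  Q * (Q ^ j * Q)         ≡⟨ sym (*-assoc Q (Q ^ j) Q) ⟩
  Q * Q ^ j * Q           ∎
  where
  open ≤-Reasoning
  shuffle : ∀ a b t → a * b * t ≡ b * (a * t)
  shuffle = solve-∀
  shuffle′ : ∀ b q t → b * (q + q * t) ≡ q * (b * (1 + t))
  shuffle′ = solve-∀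

-- For `Q = 2 * q` and `j = q` the preceding bound Q/(Q - j) equals 2.
suc-2q^q≤ : ∀ q .{{_ : NonZero q}} → suc (2 * q) ^ q ≤ 2 * (2 * q) ^ q
suc-2q^q≤ q = *-cancelʳ-≤ _ _ q (≤-trans (suc^*≤ q q (2 * q) (cong (q +_) (sym (+-identityʳ q)))) (≤-reflexive (shuffle q ((2 * q) ^ q))))
  where
  shuffle : ∀ q b → b * (2 * q) ≡ 2 * b * q
  shuffle = solve-∀

-- (1 + 1/P)^j ≥ 1 + j/P
bernoulli : ∀ P j → P ^ j * (P + j) ≤ P * suc P ^ j
bernoulli P zero = ≤-reflexive (shuffle P)
  where
  shuffle : ∀ P → 1 * (P + 0) ≡ P * 1
  shuffle = solve-∀
bernoulli P (suc j) = begin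
  P * P ^ j * (P + suc j)        ≡⟨ shuffle P (P ^ j) j ⟩
  P ^ j * (P * (P + j) + P)      ≤⟨ *-monoʳ-≤ (P ^ j) (+-monoʳ-≤ (P * (P + j)) (m≤m+n P j)) ⟩
  P ^ j * (P * (P + j) + (P + j)) ≡⟨ shuffle′ P (P ^ j) (P + j) ⟩
  suc P * (P ^ j * (P + j))      ≤⟨ *-monoʳ-≤ (suc P) (bernoulli P j) ⟩
  suc P * (P * suc P ^ j)        ≡⟨ shuffle″ (suc P) P (suc P ^ j) ⟩
  P * (suc P * suc P ^ j)        ∎
  where
  open ≤-Reasoning
  shuffle : ∀ P x j → P * x * (P + (1 + j)) ≡ x * (P * (P + j) + P)
  shuffle = solve-∀
  shuffle′ : ∀ P x s → x * (P * s + s) ≡ (1 + P) * (x * s)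
  shuffle′ = solve-∀
  shuffle″ : ∀ a b c → a * (b * c) ≡ b * (a * c)
  shuffle″ = solve-∀

2*P^P≤ : ∀ P .{{_ : NonZero P}} → 2 * P ^ P ≤ suc P ^ P
2*P^P≤ P = *-cancelˡ-≤ P (≤-trans (≤-reflexive (shuffle P (P ^ P))) (bernoulli P P))
  where
  shuffle : ∀ P x → P * (2 * x) ≡ x * (P + P)
  shuffle = solve-∀


^-distribʳ-* : ∀ a b n → (a * b) ^ n ≡ a ^ n * b ^ n
^-distribʳ-* a b zero = refl
^-distribʳ-* a b (suc n) = trans (cong (a * b *_) (^-distribʳ-* a b n)) (shuffle a b (a ^ n) (b ^ n))
  where
  shuffle : ∀ a b c d → a * b * (c * d) ≡ a * c * (b * d)
  shuffle = solve-∀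

-- (1 + 1/2q)^r ≤ 2^δ
suc-2q^r≤ : ∀ q δ r .{{_ : NonZero q}} → r ≤ q * δ → suc (2 * q) ^ r ≤ 2 ^ δ * (2 * q) ^ r
suc-2q^r≤ q δ r r≤qδ with m≤n⇒∃[o]m+o≡n r≤qδ
... | t , r+t≡qδ = *-cancelʳ-≤ _ _ (b ^ t) {{m^n≢0 b t {{m*n≢0 2 q}}}} (begin
  suc b ^ r * b ^ t      ≤⟨ *-monoʳ-≤ (suc b ^ r) (^-monoˡ-≤ t (n≤1+n b)) ⟩
  suc b ^ r * suc b ^ t  ≡⟨ sym (^-distribˡ-+-* (suc b) r t) ⟩
  suc b ^ (r + t)        ≡⟨ cong (suc b ^_) r+t≡qδ ⟩
  suc b ^ (q * δ)        ≡⟨ sym (^-*-assoc (suc b) q δ) ⟩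
  (suc b ^ q) ^ δ        ≤⟨ ^-monoˡ-≤ δ (suc-2q^q≤ q) ⟩
  (2 * b ^ q) ^ δ        ≡⟨ ^-distribʳ-* 2 (b ^ q) δ ⟩
  2 ^ δ * (b ^ q) ^ δ    ≡⟨ cong (2 ^ δ *_) (^-*-assoc b q δ) ⟩
  2 ^ δ * b ^ (q * δ)    ≡⟨ cong (λ e → 2 ^ δ * b ^ e) (sym r+t≡qδ) ⟩
  2 ^ δ * b ^ (r + t)    ≡⟨ cong (2 ^ δ *_) (^-distribˡ-+-* b r t) ⟩
  2 ^ δ * (b ^ r * b ^ t) ≡⟨ sym (*-assoc (2 ^ δ) _ _) ⟩
  2 ^ δ * b ^ r * b ^ t  ∎)
  where
  open ≤-Reasoning
  b = 2 * q

-- (1 − 1/(P+1))^K ≤ 2^(−g)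
2^*P^≤ : ∀ P g K .{{_ : NonZero P}} → P * g ≤ K → 2 ^ g * P ^ K ≤ suc P ^ K
2^*P^≤ P g K Pg≤K with m≤n⇒∃[o]m+o≡n Pg≤K
... | t , refl = begin
  2 ^ g * P ^ (P * g + t)          ≡⟨ cong (2 ^ g *_) (^-distribˡ-+-* P (P * g) t) ⟩
  2 ^ g * (P ^ (P * g) * P ^ t)    ≡⟨ sym (*-assoc (2 ^ g) _ _) ⟩
  2 ^ g * P ^ (P * g) * P ^ t      ≡⟨ cong (λ e → 2 ^ g * e * P ^ t) (sym (^-*-assoc P P g)) ⟩
  2 ^ g * (P ^ P) ^ g * P ^ t      ≡⟨ cong (_* P ^ t) (sym (^-distribʳ-* 2 (P ^ P) g)) ⟩
  (2 * P ^ P) ^ g * P ^ t          ≤⟨ *-mono-≤ (^-monoˡ-≤ g (2*P^P≤ P)) (^-monoˡ-≤ t (n≤1+n P)) ⟩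
  (suc P ^ P) ^ g * suc P ^ t      ≡⟨ cong (_* suc P ^ t) (^-*-assoc (suc P) P g) ⟩
  suc P ^ (P * g) * suc P ^ t      ≡⟨ sym (^-distribˡ-+-* (suc P) (P * g) t) ⟩
  suc P ^ (P * g + t)              ∎
  where open ≤-Reasoning

-- Random maps with few collisions

infix 7 _==_
_==_ : ∀ {n} → Fin n → Fin n → Bool
x == y = does (x Fin.≟ y)

==⇒≡ : ∀ {n} {x y : Fin n} → x == y ≡ true → x ≡ y
==⇒≡ {x = x} {y} eq with x Fin.≟ y
... | yes p = p

≢⇒== : ∀ {n} {x y : Fin n} → x ≢ y → x == y ≡ false
≢⇒== {x = x} {y} ne = dec-false (x Fin.≟ y) ne

≡⇒== : ∀ {n} {x y : Fin n} → x ≡ y → x == y ≡ true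
≡⇒== {x = x} {y} p = dec-true (x Fin.≟ y) p

count-cong : {p q : X → Bool} (xs : List X) → (∀ x → p x ≡ q x) → count p xs ≡ count q xs
count-cong xs p≗q = cong List∑ (List.map-cong (λ x → cong (λ b → if b then 1 else 0) (p≗q x)) xs)

hit : (Fin n → Fin r → Fin m) → Fin n → Vec (Fin n) p → Fin r → Bool
hit φ u [] j = false
hit φ u (w ∷ S) j = φ u j == φ w j ∨ hit φ u S j

-- For each colour j, an entry of the tuple counts if its value under φ · j recurs later in the tuple.
collisions : (Fin n → Fin r → Fin m) → Vec (Fin n) p → ℕ
collisions φ [] = 0
collisions {r = r} φ (u ∷ S) = count (hit φ u S) (allFin r) + collisions φ S

hit-cong : {φ ψ : Fin n → Fin r → Fin m} (u : Fin n) (S : Vec (Fin n) p) (j : Fin r) →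
  φ u j ≡ ψ u j → VecAll.All (λ w → φ w j ≡ ψ w j) S → hit φ u S j ≡ hit ψ u S j
hit-cong u [] j e [] = refl
hit-cong u (w ∷ S) j e (f ∷ fs) = cong₂ _∨_ (cong₂ _==_ e f) (hit-cong u S j e fs)

collisions-cong : {φ ψ : Fin n → Fin r → Fin m} (S : Vec (Fin n) p) →
  VecAll.All (λ w → ∀ j → φ w j ≡ ψ w j) S → collisions φ S ≡ collisions ψ S
collisions-cong [] [] = refl
collisions-cong {r = r} (u ∷ S) (e ∷ es) = cong₂ _+_
  (count-cong (allFin r) λ j → hit-cong u S j (e j) (VecAll.map (λ f → f j) es)) (collisions-cong S es)

hit-true : (φ : Fin n → Fin r → Fin m) {u w : Fin n} {S : Vec (Fin n) p} {j : Fin r} →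
  w Vec.∈ S → φ u j ≡ φ w j → hit φ u S j ≡ true
hit-true φ (here refl) e rewrite ≡⇒== e = refl
hit-true φ {u} {S = x ∷ _} {j} (there i) e rewrite hit-true φ {u} i e = ∨-zeroʳ (φ u j == φ x j)

hit-witness : (φ : Fin n → Fin r → Fin m) {u : Fin n} {S : Vec (Fin n) p} {j : Fin r} →
  hit φ u S j ≡ true → ∃ λ w → w Vec.∈ S × φ u j ≡ φ w j
hit-witness φ {u} {S = w ∷ S} {j} h with φ u j == φ w j in eq
... | true = w , here refl , ==⇒≡ eq
... | false with hit-witness φ {S = S} h
...   | x , x∈ , e = x , there x∈ , e

sum-if-== : ∀ {m} y (b : Fin m) → sum (λ x → if x == b then y else 0) ≤ y
sum-if-== {suc m} y zero = ≤-reflexive (trans (cong (y +_) (trans (sum-const m 0) (*-zeroʳ m))) (+-identityʳ y))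
sum-if-== {suc m} y (suc b) = ≤-trans (≤-reflexive (sum-cong-≗ {m} λ x → refl)) (sum-if-== y b)

-- At most `p` values satisfy `h`, since `f` lists them all; the induction removes `f zero` from
-- `h`.
sum-if-∈ : ∀ {m} y (f : Fin p → Fin m) (h : Fin m → Bool) → (∀ x → h x ≡ true → ∃ λ a → x ≡ f a) →
  sum (λ x → if h x then y else 1) ≤ m + p * y
sum-if-∈ {zero} {m} y f h wit = ≤-trans (sum-mono {g = λ _ → 1} bound) (≤-reflexive (trans (sum-const m 1) (trans (*-identityʳ m) (sym (+-identityʳ m)))))
  where
  bound : ∀ x → (if h x then y else 1) ≤ 1
  bound x with h x in eq
  ... | false = ≤-refl
  ... | true with () ← proj₁ (wit x eq)
sum-if-∈ {suc p} {m} y f h wit = begin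
  sum (λ x → if h x then y else 1)  ≤⟨ sum-mono split ⟩
  sum (λ x → (if x == f zero then y else 0) + (if h′ x then y else 1))
    ≡⟨ ∑-distrib-+ (λ x → if x == f zero then y else 0) _ ⟩
  sum (λ x → if x == f zero then y else 0) + sum (λ x → if h′ x then y else 1)
    ≤⟨ +-mono-≤ (sum-if-== y (f zero)) (sum-if-∈ y (f ∘ suc) h′ wit′) ⟩
  y + (m + p * y)  ≡⟨ shuffle y m (p * y) ⟩
  m + (y + p * y)  ∎
  where
  open ≤-Reasoning
  h′ : Fin m → Bool
  h′ x = h x ∧ not (x == f zero)
  split : ∀ x → (if h x then y else 1) ≤ (if x == f zero then y else 0) + (if h′ x then y else 1)
  split x with h x | x == f zero
  ... | true | true = m≤m+n y 1
  ... | true | false = ≤-refl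
  ... | false | true = m≤n+m 1 y
  ... | false | false = ≤-refl
  wit′ : ∀ x → h′ x ≡ true → ∃ λ a → x ≡ f (suc a)
  wit′ x e with h x in hx | x Fin.≟ f zero
  ... | true | no ne with wit x hx
  ...   | zero , e′ = contradiction e′ ne
  ...   | suc a , e′ = a , e′
  shuffle : ∀ a b c → a + (b + c) ≡ b + (a + c)
  shuffle = solve-∀

at : Vec (Fin m) (n * r) → Fin n → Fin r → Fin m
at v u j = lookup v (combine u j)

at-update : ∀ (v : Vec (Fin m) (n * r)) u j x → at {n = n} (v [ combine u j ]≔ x) u j ≡ x
at-update {n = n} v u j x = lookup∘update (combine {n} u j) v x

at-update-≢ : ∀ (v : Vec (Fin m) (n * r)) {u w : Fin n} {j l : Fin r} x → ¬ (u ≡ w × j ≡ l) →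
  at {n = n} (v [ combine u j ]≔ x) w l ≡ at v w l
at-update-≢ v {u} {w} {j} {l} x ne = lookup∘update′ {i = combine w l} (λ e → let p , q = Fin.combine-injective w l u j e in ne (sym p , sym q)) v x

-- Exponential moment of the number of collisions. Given the images of `S`, the image of `u` in a
-- colour hits one of fewer than `k` values, so its factor has mean at most 1 + ky/m, hence at most
-- 1 + 1/(2r). Over `r` independent colours this costs a factor of at most 2 for each vertex of the
-- tuple.
E-collisions : ∀ {y k} .{{_ : NonZero r}} → 2 * r * (k * y) ≤ m → (S : Vec (Fin n) p) → Unique S → p ≤ k →
  E {m} {n * r} (λ v → y ^ collisions (at v) S) ≤ 2 ^ p * m ^ (n * r)
E-collisions {r = r} {m} {n} _ [] _ _ = ≤-reflexive (trans (E-const {m} {n * r} 1) (trans (*-identityʳ _) (sym (*-identityˡ _))))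
E-collisions {r = r} {m} {n} {suc p} {y} {k} 2rky≤m (u ∷ S) (u∉S ∷ uS) p<k = begin
  E (λ v → y ^ collisions (at v) (u ∷ S))           ≡⟨ E-cong {m} {n * r} split ⟩
  E {m} {n * r} (λ v → Π (allFin r) (λ j → w j v) * h v)
    ≤⟨ *-cancelˡ-≤ ((2 * r) ^ r) {{m^n≢0 (2 * r) r {{m*n≢0 2 r}}}} peeled ⟩
  2 * E h
    ≤⟨ *-monoʳ-≤ 2 (E-collisions 2rky≤m S uS (≤-trans (n≤1+n p) p<k)) ⟩
  2 * (2 ^ p * m ^ (n * r))                         ≡⟨ sym (*-assoc 2 (2 ^ p) _) ⟩
  2 ^ suc p * m ^ (n * r)                           ∎
  where
  open ≤-Reasoning
  w : Fin r → Vec (Fin m) (n * r) → ℕ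
  w j v = if hit (at v) u S j then y else 1
  h : Vec (Fin m) (n * r) → ℕ
  h v = y ^ collisions (at v) S
  split : ∀ v → y ^ collisions (at v) (u ∷ S) ≡ Π (allFin r) (λ j → w j v) * h v
  split v = trans (^-distribˡ-+-* y (count (hit (at v) u S) (allFin r)) _) (cong (_* h v) (sym (Π-if y (hit (at v) u S) (allFin r))))
  h-indep : ∀ j κ → κ ≡ combine u j → Indep κ h
  h-indep j _ refl v x = cong (y ^_) (collisions-cong S (VecAll.map (λ ne l → at-update-≢ v x (ne ∘ proj₁)) u∉S))
  w-indep : AllPairs (λ j l → ∀ κ → κ ≡ combine u j → Indep κ (w l)) (allFin r)
  w-indep = AllPairs.map (λ { {j} {l} j≢l _ refl v x → cong (λ b → if b then y else 1)
    (hit-cong u S l (at-update-≢ v {u} {u} x (j≢l ∘ proj₂)) (VecAll.universal (λ w → at-update-≢ v {u} {w} x (j≢l ∘ proj₂)) S)) }) (allFin⁺ r)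
  step : ∀ j g → (∀ κ → κ ≡ combine u j → Indep κ g) → 2 * r * E (λ v → w j v * g v) ≤ suc (2 * r) * E g
  step j g ind = E-peel (combine u j) {w j} (2 * r) (suc (2 * r)) (ind _ refl) bound
    where
    bound : ∀ v → 2 * r * sum (λ x → w j (v [ combine u j ]≔ x)) ≤ suc (2 * r) * m
    bound v = begin
      2 * r * sum (λ x → w j (v [ combine u j ]≔ x))
        ≤⟨ *-monoʳ-≤ (2 * r) (sum-if-∈ y (λ a → at v (lookup S a) j) _ wit) ⟩
      2 * r * (m + p * y)        ≡⟨ *-distribˡ-+ (2 * r) m (p * y) ⟩
      2 * r * m + 2 * r * (p * y)
        ≤⟨ +-monoʳ-≤ (2 * r * m) (*-monoʳ-≤ (2 * r) (*-monoˡ-≤ y (≤-trans (n≤1+n p) p<k))) ⟩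
      2 * r * m + 2 * r * (k * y) ≤⟨ +-monoʳ-≤ (2 * r * m) 2rky≤m ⟩
      2 * r * m + m               ≡⟨ +-comm (2 * r * m) m ⟩
      suc (2 * r) * m             ∎
      where
      wit : ∀ x → hit (at (v [ combine u j ]≔ x)) u S j ≡ true → ∃ λ a → x ≡ at v (lookup S a) j
      wit x e with hit-witness (at (v [ combine u j ]≔ x)) {u} {S = S} {j} e
      ... | w , w∈ , eq = VecAny.index w∈ , trans (sym (at-update v u j x)) (trans eq (trans
              (at-update-≢ v x (λ (u≡w , _) → VecAll.lookup u∉S w∈ u≡w)) (cong (λ z → at v z j) (VecAny.lookup-index w∈))))
  peeled : (2 * r) ^ r * E (λ v → Π (allFin r) (λ j → w j v) * h v) ≤ (2 * r) ^ r * (2 * E h)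
  peeled = begin
    (2 * r) ^ r * E (λ v → Π (allFin r) (λ j → w j v) * h v)
      ≡⟨ cong (λ l → (2 * r) ^ l * E (λ v → Π (allFin r) (λ j → w j v) * h v)) (sym (length-allFin r)) ⟩
    (2 * r) ^ length (allFin r) * E (λ v → Π (allFin r) (λ j → w j v) * h v)
      ≤⟨ E-Π-peel w (λ j κ → κ ≡ combine u j) (2 * r) (suc (2 * r)) step (allFin r) w-indep h h-indep ⟩
    suc (2 * r) ^ length (allFin r) * E h
      ≡⟨ cong (λ l → suc (2 * r) ^ l * E h) (length-allFin r) ⟩
    suc (2 * r) ^ r * E h
      ≤⟨ *-monoˡ-≤ (E h) (suc-2q^q≤ r) ⟩
    2 * (2 * r) ^ r * E h
      ≡⟨ shuffle ((2 * r) ^ r) (E h) ⟩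
    (2 * r) ^ r * (2 * E h) ∎
    where
    shuffle : ∀ a b → 2 * a * b ≡ a * (2 * b)
    shuffle = solve-∀

^-cancel-< : ∀ y .{{_ : NonZero y}} {a b} → y ^ a < y ^ b → a < b
^-cancel-< y {a} {b} lt with a <? b
... | yes p = p
... | no ¬p = contradiction (^-monoʳ-≤ y (≮⇒≥ ¬p)) (<⇒≱ lt)

-- Markov's inequality for `y ^ collisions`, with a union bound over all `k`-tuples and all pairs of
-- vertices. The 16 for pairs is `2 ^ 2 * 4`.
few-collisions : ∀ {y k L δ} .{{_ : NonZero r}} .{{_ : NonZero y}} → 1 ≤ m → 2 * r * (k * y) ≤ m → 2 ≤ k →
  n ^ k * 2 ^ k * 4 ≤ y ^ L → n ^ 2 * 16 ≤ y ^ δ →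
  ∃ λ (φ : Fin n → Fin r → Fin m) →
    (∀ (S : Vec (Fin n) k) → Unique S → collisions φ S < L) ×
    (∀ (S : Vec (Fin n) 2) → Unique S → collisions φ S < δ)
few-collisions {r} {m} {n} {y} {k} {L} {δ} m≥1 2rky≤m k≥2 hL hδ =
  let v , A , B = avoid-both m≥1 (rare k L ≤-refl hL) (rare 2 δ k≥2 (≤-trans (≤-reflexive (16≡ (n ^ 2))) hδ))
  in at v , (λ S u → ^-cancel-< y (A S (∈-vecs S) u)) , (λ S u → ^-cancel-< y (B S (∈-vecs S) u))
  where
  open ≤-Reasoning
  16≡ : ∀ a → a * 4 * 4 ≡ a * 16
  16≡ = solve-∀
  shuffle : ∀ a b t → 4 * (a * (b * t)) ≡ a * b * 4 * t
  shuffle = solve-∀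
  rare : ∀ p θ → p ≤ k → n ^ p * 2 ^ p * 4 ≤ y ^ θ →
    Rare {m} {n * r} Unique (vecs n p) (λ S v → y ^ collisions (at v) S) (y ^ θ)
  rare p θ p≤k h = record
    { dec = allPairs? λ a b → ¬? (a Fin.≟ b)
    ; q = 1
    ; M = 2 ^ p * m ^ (n * r)
    ; q-pos = ≤-refl
    ; θ-pos = m^n>0 y θ
    ; mean = λ S u → ≤-trans (≤-reflexive (*-identityˡ _)) (E-collisions {y = y} {k} 2rky≤m S u p≤k)
    ; small = begin
        4 * (length (vecs n p) * (2 ^ p * m ^ (n * r)))
          ≡⟨ cong (λ l → 4 * (l * (2 ^ p * m ^ (n * r)))) (length-vecs n p) ⟩
        4 * (n ^ p * (2 ^ p * m ^ (n * r)))             ≡⟨ shuffle (n ^ p) (2 ^ p) _ ⟩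
        n ^ p * 2 ^ p * 4 * m ^ (n * r)                 ≤⟨ *-monoˡ-≤ (m ^ (n * r)) h ⟩
        y ^ θ * m ^ (n * r)
          ≡⟨ cong (_* m ^ (n * r)) (sym (*-identityˡ (y ^ θ))) ⟩
        1 * y ^ θ * m ^ (n * r)                         ∎
    }

-- Spread subtuples

-- Only later entries count: in each colour, the last of any group of coinciding entries stays
-- unshared, so unshared entries have distinct images.
shared : (Fin n → Fin r → Fin m) → Vec (Fin n) p → Fin p → Fin r → Bool
shared φ (u ∷ S) zero j = hit φ u S j
shared φ (u ∷ S) (suc a) j = shared φ S a j

Spread : ℕ → (Fin n → Fin r → Fin m) → Vec (Fin n) p → Set
Spread {r = r} δ φ S = ∀ a → count (shared φ S a) (allFin r) < δ

unshared-injective : (φ : Fin n → Fin r → Fin m) (S : Vec (Fin n) p) {a b : Fin p} {j : Fin r} →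
  shared φ S a j ≡ false → shared φ S b j ≡ false → φ (lookup S a) j ≡ φ (lookup S b) j → a ≡ b
unshared-injective φ (u ∷ S) {zero} {zero} _ _ _ = refl
unshared-injective φ (u ∷ S) {zero} {suc b} fa _ e with () ← trans (sym fa) (hit-true φ (∈-lookup b S) e)
unshared-injective φ (u ∷ S) {suc a} {zero} _ fb e with () ← trans (sym fb) (hit-true φ (∈-lookup a S) (sym e))
unshared-injective φ (u ∷ S) {suc a} {suc b} fa fb e = cong suc (unshared-injective φ S fa fb e)

-- Markov's inequality: at most (collisions φ S)/δ entries have to be dropped.
spread-subtuple : ∀ {δ} → 1 ≤ δ → (φ : Fin n → Fin r → Fin m) (S : Vec (Fin n) p) → Unique S →
  ∀ t → collisions φ S + t * δ ≤ p * δ →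
  ∃ λ (T : Vec (Fin n) t) → Unique T × (∀ w → w Vec.∈ T → w Vec.∈ S) × Spread δ φ T
spread-subtuple δ≥1 φ S uS zero _ = [] , [] , (λ _ ()) , λ ()
spread-subtuple {δ = suc _} δ≥1 φ [] uS (suc t) ()
spread-subtuple {r = r} {p = suc p} {δ = δ} δ≥1 φ (u ∷ S) (u∉S ∷ uS) (suc t) h with count (hit φ u S) (allFin r) <? δ
... | yes c<δ =
  let T , uT , T⊆S , spread = spread-subtuple δ≥1 φ S uS t (+-cancelˡ-≤ δ _ _ (begin
        δ + (collisions φ S + t * δ)      ≡⟨ shuffle δ (collisions φ S) (t * δ) ⟩
        collisions φ S + suc t * δ
          ≤⟨ +-monoˡ-≤ (suc t * δ) (m≤n+m (collisions φ S) (count (hit φ u S) (allFin r))) ⟩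
        collisions φ (u ∷ S) + suc t * δ  ≤⟨ h ⟩
        suc p * δ                         ∎))
  in u ∷ T
   , VecAll.lookup⁻ (λ i → VecAll.lookup u∉S (T⊆S _ (∈-lookup i T))) ∷ uT
   , (λ { w (here e) → here e ; w (there i) → there (T⊆S w i) })
   -- Passing from `S` to the subtuple `T` can only lose hits.
   , (λ { zero → ≤-<-trans (count-mono (allFin r) λ j e → let w , w∈ , eq = hit-witness φ {S = T} e in hit-true φ (T⊆S w w∈) eq) c<δ
        ; (suc a) → spread a })
  where
  open ≤-Reasoning
  shuffle : ∀ a b c → a + (b + c) ≡ b + (a + c)
  shuffle = solve-∀
... | no c≮δ =
  let T , uT , T⊆S , spread = spread-subtuple δ≥1 φ S uS (suc t) (+-cancelˡ-≤ δ _ _ (begin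
        δ + (collisions φ S + suc t * δ)   ≤⟨ +-monoˡ-≤ _ (≮⇒≥ c≮δ) ⟩
        count (hit φ u S) (allFin r) + (collisions φ S + suc t * δ)
          ≡⟨ sym (+-assoc (count (hit φ u S) (allFin r)) _ _) ⟩
        collisions φ (u ∷ S) + suc t * δ   ≤⟨ h ⟩
        suc p * δ                          ∎))
  in T , uT , (λ w i → there (T⊆S w i)) , spread
  where open ≤-Reasoning

-- Random graphs and their edge counts

-- Sorting before encoding makes both orders of a pair read the same random coordinate, so that the
-- random graphs are undirected.
ukey : Fin m → Fin m → Fin (m * m)
ukey x y with Fin.≤-total x y
... | inj₁ _ = combine x y
... | inj₂ _ = combine y x

ukey-comm : (x y : Fin m) → ukey x y ≡ ukey y x
ukey-comm x y with Fin.≤-total x y | Fin.≤-total y x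
... | inj₁ p | inj₁ q rewrite Fin.≤-antisym p q = refl
... | inj₁ p | inj₂ _ = refl
... | inj₂ _ | inj₁ q = refl
... | inj₂ p | inj₂ q rewrite Fin.≤-antisym p q = refl

ukey-injective : {x y x′ y′ : Fin m} → ukey x y ≡ ukey x′ y′ → SamePair (x , y) (x′ , y′)
ukey-injective {x = x} {y} {x′} {y′} e with Fin.≤-total x y | Fin.≤-total x′ y′
... | inj₁ _ | inj₁ _ = inj₁ (Fin.combine-injective x y x′ y′ e)
... | inj₁ _ | inj₂ _ = inj₂ (Fin.combine-injective x y y′ x′ e)
... | inj₂ _ | inj₁ _ = let p , q = Fin.combine-injective y x x′ y′ e in inj₂ (q , p)
... | inj₂ _ | inj₂ _ = let p , q = Fin.combine-injective y x y′ x′ e in inj₁ (q , p)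

key : Fin r → Fin m × Fin m → Fin (r * (m * m))
key j (x , y) = combine j (ukey x y)

key-injective : (j l : Fin r) (e f : Fin m × Fin m) → key j e ≡ key l f → j ≡ l × SamePair e f
key-injective j l (x , y) (x′ , y′) eq =
  let p , q = Fin.combine-injective j (ukey x y) l (ukey x′ y′) eq in p , ukey-injective q

isZero : Fin Q → Bool
isZero zero = true
isZero (suc _) = false

sum-isZero : ∀ Q a b → sum {suc Q} (λ x → if isZero x then a else b) ≡ a + Q * b
sum-isZero Q a b = cong (a +_) (sum-const Q b)

-- The pair e is a non-edge of the j-th random graph with probability 1/Q.
absent : Vec (Fin Q) (r * (m * m)) → Fin r → Fin m × Fin m → Bool
absent ω j e = isZero (lookup ω (key j e))

absent-update : (ω : Vec (Fin Q) (r * (m * m))) {κ : Fin (r * (m * m))} (j : Fin r) (e : Fin m × Fin m) (x : Fin Q) →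
  κ ≢ key j e → absent (ω [ κ ]≔ x) j e ≡ absent ω j e
absent-update ω j e x ne = cong isZero (lookup∘update′ (ne ∘ sym) ω x)

lookup₂ : Vec X p → Fin p × Fin p → X × X
lookup₂ T (a , b) = lookup T a , lookup T b

SamePair-map : {Y : Set} {f : X → Y} → ∀ {a b c d} → SamePair (f a , f b) (f c , f d) →
  (∀ {x y} → f x ≡ f y → x ≡ y) → SamePair (a , b) (c , d)
SamePair-map (inj₁ (p , q)) inj = inj₁ (inj p , inj q)
SamePair-map (inj₂ (p , q)) inj = inj₂ (inj p , inj q)

-- Exponential moment of the number of edges. Distinct points give distinct keys to distinct pairs,
-- so the factors are independent; each takes the value 1 once and the value 2 `P` times among
-- `suc P` outcomes.
E-density : ∀ P (c : Fin r) (T : Vec (Fin m) p) → Unique T →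
  suc P ^ length (pairs p) * E {suc P} {r * (m * m)} (λ ω → Π (pairs p) λ e → if absent ω c (lookup₂ T e) then 1 else 2)
    ≤ (1 + P * 2) ^ length (pairs p) * suc P ^ (r * (m * m))
E-density {r} {m} {p} P c T uT = begin
  suc P ^ K * E (λ ω → Π (pairs p) λ e → w e ω)
    ≡⟨ cong (suc P ^ K *_) (E-cong λ ω → sym (*-identityʳ (Π (pairs p) λ e → w e ω))) ⟩
  suc P ^ K * E (λ ω → (Π (pairs p) λ e → w e ω) * 1)
    ≤⟨ E-Π-peel w (λ e κ → κ ≡ key c (lookup₂ T e)) (suc P) (1 + P * 2) step (pairs p) indep (λ _ → 1) (λ _ _ _ _ _ → refl) ⟩
  (1 + P * 2) ^ K * E {suc P} {r * (m * m)} (λ _ → 1)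
    ≡⟨ cong ((1 + P * 2) ^ K *_) (trans (E-const {suc P} {r * (m * m)} 1) (*-identityʳ _)) ⟩
  (1 + P * 2) ^ K * suc P ^ (r * (m * m))               ∎
  where
  open ≤-Reasoning
  K = length (pairs p)
  w : Fin p × Fin p → Vec (Fin (suc P)) (r * (m * m)) → ℕ
  w e ω = if absent ω c (lookup₂ T e) then 1 else 2
  step : ∀ e h → (∀ κ → κ ≡ key c (lookup₂ T e) → Indep κ h) →
    suc P * E (λ ω → w e ω * h ω) ≤ (1 + P * 2) * E h
  step e h ind = E-peel κ {w e} (suc P) (1 + P * 2) (ind κ refl) λ ω → ≤-reflexive (begin-equality
    suc P * sum (λ x → w e (ω [ κ ]≔ x))
      ≡⟨ cong (suc P *_) (sum-cong-≗ λ x → cong (λ z → if isZero z then 1 else 2) (lookup∘update κ ω x)) ⟩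
    suc P * sum {suc P} (λ x → if isZero x then 1 else 2) ≡⟨ cong (suc P *_) (sum-isZero P 1 2) ⟩
    suc P * (1 + P * 2)                           ≡⟨ *-comm (suc P) (1 + P * 2) ⟩
    (1 + P * 2) * suc P                           ∎)
    where κ = key c (lookup₂ T e)
  indep : AllPairs (λ e f → ∀ κ → κ ≡ key c (lookup₂ T e) → Indep κ (w f)) (pairs p)
  indep = AllPairs.map (λ { {e} {f} ne _ refl ω x → cong (λ b → if b then 1 else 2)
    (absent-update ω c (lookup₂ T f) x λ eq → ne (SamePair-map {f = lookup T} (proj₂ (key-injective c c (lookup₂ T e) (lookup₂ T f) eq)) (Unique.lookup-injective uT _ _))) }) (pairs-distinct p)

-- Weights of pairs that miss many colours

module _ (φ : Fin n → Fin r → Fin m) (S : Vec (Fin n) p) (c : Fin r) where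

  -- In live colours distinct pairs of entries read distinct coordinates, and none of these belongs
  -- to the colour `c` of the clique.
  live : Fin p × Fin p → Fin r → Bool
  live (a , b) j = (not (shared φ S a j) ∧ not (shared φ S b j)) ∧ not (j == c)

  image : Fin r → Fin p × Fin p → Fin m × Fin m
  image j (a , b) = φ (lookup S a) j , φ (lookup S b) j

  live-≢ : ∀ e {j} → live e j ≡ true → j ≢ c
  live-≢ e {j} l j≡c rewrite ≡⇒== j≡c with () ← trans (sym (∧-zeroʳ _)) l

  live-unshared : ∀ a b {j} → live (a , b) j ≡ true → shared φ S a j ≡ false × shared φ S b j ≡ false
  live-unshared a b {j} l with shared φ S a j | shared φ S b j
  ... | false | false = refl , refl

  live-SamePair : ∀ {e f j} → live e j ≡ true → live f j ≡ true → SamePair (image j e) (image j f) →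
    SamePair e f
  live-SamePair {a , b} {a′ , b′} {j} l l′ same with live-unshared a b l | live-unshared a′ b′ l′ | same
  ... | ua , ub | ua′ , ub′ | inj₁ (p , q) = inj₁ (unshared-injective φ S ua ua′ p , unshared-injective φ S ub ub′ q)
  ... | ua , ub | ua′ , ub′ | inj₂ (p , q) = inj₂ (unshared-injective φ S ua ub′ p , unshared-injective φ S ub ua′ q)

  -- On a non-edge of colour `c` this is the exponential of the number of live non-edges. On an edge
  -- it is the constant that bounds the mean of that exponential, so the conditional mean is at most
  -- `2 ^ δ` whatever happens in colour `c`.
  weight : ℕ → (Fin r → Fin m × Fin m → Bool) → Fin p × Fin p → ℕ
  weight δ g e = if g c (image c e) then 2 ^ count (λ j → live e j ∧ g j (image j e)) (allFin r) else 2 ^ δ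

  -- Only the coordinates of live colours are averaged out: these are not used by any other pair.
  E-weight : ∀ P δ → suc (suc P) ^ r ≤ 2 ^ δ * suc P ^ r →
    E {suc P} {r * (m * m)} (λ ω → Π (pairs p) (weight δ (absent ω))) ≤ (2 ^ δ) ^ length (pairs p) * suc P ^ (r * (m * m))
  E-weight P δ hδ = begin
    E (λ ω → Π (pairs p) λ e → w e ω)
      ≡⟨ E-cong (λ ω → sym (*-identityʳ (Π (pairs p) λ e → w e ω))) ⟩
    E (λ ω → (Π (pairs p) λ e → w e ω) * 1)
      ≡⟨ sym (trans (cong (_* E (λ ω → (Π (pairs p) λ e → w e ω) * 1)) (^-zeroˡ K)) (*-identityˡ _)) ⟩
    1 ^ K * E (λ ω → (Π (pairs p) λ e → w e ω) * 1)
      ≤⟨ E-Π-peel w κs 1 (2 ^ δ) step (pairs p) indep (λ _ → 1) (λ _ _ _ _ _ → refl) ⟩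
    (2 ^ δ) ^ K * E {suc P} {r * (m * m)} (λ _ → 1)
      ≡⟨ cong ((2 ^ δ) ^ K *_) (trans (E-const {suc P} {r * (m * m)} 1) (*-identityʳ _)) ⟩
    (2 ^ δ) ^ K * suc P ^ (r * (m * m))              ∎
    where
    open ≤-Reasoning
    Ω = Vec (Fin (suc P)) (r * (m * m))
    K = length (pairs p)
    w : Fin p × Fin p → Ω → ℕ
    w e ω = weight δ (absent ω) e
    κs : Fin p × Fin p → Fin (r * (m * m)) → Set
    κs e κ = ∃ λ j → live e j ≡ true × κ ≡ key j (image j e)
    indep : AllPairs (λ e f → ∀ κ → κs e κ → Indep κ (w f)) (pairs p)
    indep = AllPairs.map (λ { {e} {f} ne _ (j , l , refl) ω x → cong₂ (λ b t → if b then 2 ^ t else 2 ^ δ)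
      (absent-update ω c (image c f) x (λ eq → live-≢ e l (proj₁ (key-injective j c (image j e) (image c f) eq))))
      (count-cong (allFin r) (other e f ne j l ω x)) }) (pairs-distinct p)
      where
      other : ∀ e f → ¬ SamePair e f → ∀ j → live e j ≡ true → ∀ (ω : Ω) x i →
        (live f i ∧ absent (ω [ key j (image j e) ]≔ x) i (image i f)) ≡ (live f i ∧ absent ω i (image i f))
      other e f ne j l ω x i with live f i in l′
      ... | false = refl
      ... | true = absent-update ω i (image i f) x λ eq → case-eq (key-injective j i (image j e) (image i f) eq)
        where
        case-eq : ¬ (j ≡ i × SamePair (image j e) (image i f))
        case-eq (refl , same) = ne (live-SamePair {e} {f} l l′ same)
    step : ∀ e h → (∀ κ → κs e κ → Indep κ h) → 1 * E (λ ω → w e ω * h ω) ≤ 2 ^ δ * E h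
    step e h ind = begin
      1 * E (λ ω → w e ω * h ω)                              ≡⟨ *-identityˡ _ ⟩
      E (λ ω → w e ω * h ω)                                  ≡⟨ E-cong split ⟩
      -- `z` and `nz` are the indicators of a non-edge and an edge in colour `c`. Live colours
      -- differ from `c`, so `z` can be carried along with `h` while `G` is averaged.
      E (λ ω → G ω * (z ω * h ω) + 2 ^ δ * (nz ω * h ω))
        ≡⟨ E-+ (λ ω → G ω * (z ω * h ω)) (λ ω → 2 ^ δ * (nz ω * h ω)) ⟩
      E (λ ω → G ω * (z ω * h ω)) + E (λ ω → 2 ^ δ * (nz ω * h ω))
        ≤⟨ +-mono-≤ (*-cancelˡ-≤ (suc P ^ r) {{m^n≢0 (suc P) r}} peeled) (≤-reflexive (E-* (2 ^ δ) (λ ω → nz ω * h ω))) ⟩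
      2 ^ δ * E (λ ω → z ω * h ω) + 2 ^ δ * E (λ ω → nz ω * h ω) ≡⟨ sym (*-distribˡ-+ (2 ^ δ) _ _) ⟩
      2 ^ δ * (E (λ ω → z ω * h ω) + E (λ ω → nz ω * h ω))
        ≡⟨ cong (2 ^ δ *_) (sym (E-+ (λ ω → z ω * h ω) (λ ω → nz ω * h ω))) ⟩
      2 ^ δ * E (λ ω → z ω * h ω + nz ω * h ω)               ≡⟨ cong (2 ^ δ *_) (E-cong whole) ⟩
      2 ^ δ * E h                                            ∎
      where
      g : Fin r → Ω → ℕ
      g j ω = if live e j ∧ absent ω j (image j e) then 2 else 1
      G z nz : Ω → ℕ
      G ω = Π (allFin r) λ j → g j ω
      z ω = if absent ω c (image c e) then 1 else 0
      nz ω = if absent ω c (image c e) then 0 else 1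
      split : ∀ ω → w e ω * h ω ≡ G ω * (z ω * h ω) + 2 ^ δ * (nz ω * h ω)
      split ω rewrite Π-if 2 (λ j → live e j ∧ absent ω j (image j e)) (allFin r) with absent ω c (image c e)
      ... | true = lemma (2 ^ count (λ j → live e j ∧ absent ω j (image j e)) (allFin r)) (2 ^ δ) (h ω)
        where
        lemma : ∀ a b h → a * h ≡ a * (1 * h) + b * (0 * h)
        lemma = solve-∀
      ... | false = lemma (2 ^ count (λ j → live e j ∧ absent ω j (image j e)) (allFin r)) (2 ^ δ) (h ω)
        where
        lemma : ∀ a b h → b * h ≡ a * (0 * h) + b * (1 * h)
        lemma = solve-∀
      whole : ∀ ω → z ω * h ω + nz ω * h ω ≡ h ω
      whole ω with absent ω c (image c e)
      ... | true = trans (+-identityʳ _) (*-identityˡ (h ω))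
      ... | false = *-identityˡ (h ω)
      κg : Fin r → Fin (r * (m * m)) → Set
      κg j κ = live e j ≡ true × κ ≡ key j (image j e)
      g-indep : AllPairs (λ j i → ∀ κ → κg j κ → Indep κ (g i)) (allFin r)
      g-indep = AllPairs.map (λ { {j} {i} j≢i _ (_ , refl) ω x → cong (λ b → if live e i ∧ b then 2 else 1)
        (absent-update ω i (image i e) x (j≢i ∘ proj₁ ∘ key-injective j i (image j e) (image i e))) }) (allFin⁺ r)
      zh-indep : ∀ j κ → κg j κ → Indep κ (λ ω → z ω * h ω)
      zh-indep j κ (l , refl) = Indep-* {f = z} {h} (λ ω x → cong (λ b → if b then 1 else 0)
        (absent-update ω c (image c e) x (live-≢ e l ∘ proj₁ ∘ key-injective j c (image j e) (image c e)))) (ind κ (j , l , refl))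
      g-step : ∀ j (H : Ω → ℕ) → (∀ κ → κg j κ → Indep κ H) →
        suc P * E (λ ω → g j ω * H ω) ≤ suc (suc P) * E H
      g-step j H indH with live e j
      ... | false = *-mono-≤ (n≤1+n (suc P)) (≤-reflexive (E-cong λ ω → *-identityˡ (H ω)))
      ... | true = E-peel κ {λ ω → if absent ω j (image j e) then 2 else 1} (suc P) (suc (suc P)) (indH κ (refl , refl)) λ ω → ≤-reflexive (begin-equality
        suc P * sum (λ x → if absent (ω [ κ ]≔ x) j (image j e) then 2 else 1)
          ≡⟨ cong (suc P *_) (sum-cong-≗ λ x → cong (λ y → if isZero y then 2 else 1) (lookup∘update κ ω x)) ⟩
        suc P * sum {suc P} (λ x → if isZero x then 2 else 1)
          ≡⟨ cong (suc P *_) (trans (sum-isZero P 2 1) (cong (2 +_) (*-identityʳ P))) ⟩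
        suc P * suc (suc P) ≡⟨ *-comm (suc P) (suc (suc P)) ⟩
        suc (suc P) * suc P ∎)
        where κ = key j (image j e)
      peeled : suc P ^ r * E (λ ω → G ω * (z ω * h ω)) ≤ suc P ^ r * (2 ^ δ * E (λ ω → z ω * h ω))
      peeled = begin
        suc P ^ r * E (λ ω → G ω * (z ω * h ω))
          ≡⟨ cong (λ l → suc P ^ l * E (λ ω → G ω * (z ω * h ω))) (sym (length-allFin r)) ⟩
        suc P ^ length (allFin r) * E (λ ω → G ω * (z ω * h ω))
          ≤⟨ E-Π-peel g κg (suc P) (suc (suc P)) g-step (allFin r) g-indep (λ ω → z ω * h ω) zh-indep ⟩
        suc (suc P) ^ length (allFin r) * E (λ ω → z ω * h ω)
          ≡⟨ cong (λ l → suc (suc P) ^ l * E (λ ω → z ω * h ω)) (length-allFin r) ⟩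
        suc (suc P) ^ r * E (λ ω → z ω * h ω)
          ≤⟨ *-monoˡ-≤ _ hδ ⟩
        2 ^ δ * suc P ^ r * E (λ ω → z ω * h ω)
          ≡⟨ shuffle (2 ^ δ) (suc P ^ r) _ ⟩
        suc P ^ r * (2 ^ δ * E (λ ω → z ω * h ω)) ∎
        where
        shuffle : ∀ a b c → a * b * c ≡ b * (a * c)
        shuffle = solve-∀

-- Two union bounds, for fixed maps `φ`. The mean of 2 to the number of edges is below `2 ^ K` by a
-- factor `2 ^ (f + f)`: one `2 ^ f` pays for the choices of a colour and a tuple of points, the
-- other forces more than `f` non-edges. For the weights, the margin `2 ^ (δ * f)` in the threshold
-- pays for the choices of a colour and a tuple of vertices.
random-graphs : ∀ {f δ k P} (φ : Fin n → Fin r → Fin m) →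
  suc (suc P) ^ r ≤ 2 ^ δ * suc P ^ r → (1 + P * 2) * (f + f) ≤ length (pairs k) →
  4 * (r * m ^ k) ≤ 2 ^ f → 4 * (r * n ^ k) ≤ 2 ^ (δ * f) →
  ∃ λ (g : Fin r → Fin m × Fin m → Bool) → (∀ j x y → g j (x , y) ≡ g j (y , x)) ×
    (∀ c (T : Vec (Fin m) k) → Unique T → f < count (λ e → g c (lookup₂ T e)) (pairs k)) ×
    (∀ c (S : Vec (Fin n) k) → Spread δ φ S → Π (pairs k) (weight φ S c δ g) < 2 ^ (δ * length (pairs k) + δ * f))
random-graphs {n} {r} {m} {f} {δ} {k} {P} φ hδ hK hA hB =
  let ω , A , B = avoid-both (s≤s z≤n) rareA rareB
  in absent ω
   , (λ j x y → cong (λ e → isZero (lookup ω (combine j e))) (ukey-comm x y))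
   , (λ c T u → dense ω c T (A (c , T) (∈-cartesianProduct⁺ (∈-allFin c) (∈-vecs T)) u))
   , (λ c S → B (c , S) (∈-cartesianProduct⁺ (∈-allFin c) (∈-vecs S)))
  where
  open ≤-Reasoning
  K = length (pairs k)
  D = r * (m * m)
  density : Vec (Fin (suc P)) D → Fin r → Vec (Fin m) k → ℕ
  density ω c T = Π (pairs k) λ e → if absent ω c (lookup₂ T e) then 1 else 2
  dense : ∀ ω c T → 2 ^ f * density ω c T < 2 ^ K → f < count (λ e → absent ω c (lookup₂ T e)) (pairs k)
  dense ω c T lt = ^-cancel-< 2 (*-cancelʳ-< (density ω c T) _ _ (subst (2 ^ f * density ω c T <_)
    (trans (sym (Π-if-not 2 (λ e → absent ω c (lookup₂ T e)) (pairs k))) (*-comm (density ω c T) _)) lt))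
  rareA : Rare {suc P} {D} (λ (c , T) → Unique T) (cartesianProduct (allFin r) (vecs m k)) (λ (c , T) ω → 2 ^ f * density ω c T) (2 ^ K)
  rareA = record
    { dec = λ (c , T) → allPairs? (λ a b → ¬? (a Fin.≟ b)) T
    ; q = suc P ^ K
    ; M = 2 ^ f * ((1 + P * 2) ^ K * suc P ^ D)
    ; q-pos = m^n>0 (suc P) K
    ; θ-pos = m^n>0 2 K
    ; mean = λ (c , T) u → begin
        suc P ^ K * E (λ ω → 2 ^ f * density ω c T)
          ≡⟨ cong (suc P ^ K *_) (E-* (2 ^ f) (λ ω → density ω c T)) ⟩
        suc P ^ K * (2 ^ f * E (λ ω → density ω c T))  ≡⟨ shuffle (suc P ^ K) (2 ^ f) _ ⟩
        2 ^ f * (suc P ^ K * E (λ ω → density ω c T))  ≤⟨ *-monoʳ-≤ (2 ^ f) (E-density P c T u) ⟩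
        2 ^ f * ((1 + P * 2) ^ K * suc P ^ D)          ∎
    ; small = begin
        4 * (length (cartesianProduct (allFin r) (vecs m k)) * (2 ^ f * ((1 + P * 2) ^ K * suc P ^ D)))
          ≡⟨ cong (λ l → 4 * (l * (2 ^ f * ((1 + P * 2) ^ K * suc P ^ D)))) (length-colours×vecs r m k) ⟩
        4 * (r * m ^ k * (2 ^ f * ((1 + P * 2) ^ K * suc P ^ D)))
          ≡⟨ shuffle′ (r * m ^ k) (2 ^ f) ((1 + P * 2) ^ K) (suc P ^ D) ⟩
        4 * (r * m ^ k) * (2 ^ f * (1 + P * 2) ^ K * suc P ^ D)
          ≤⟨ *-monoˡ-≤ _ hA ⟩
        2 ^ f * (2 ^ f * (1 + P * 2) ^ K * suc P ^ D)
          ≡⟨ shuffle″ (2 ^ f) ((1 + P * 2) ^ K) (suc P ^ D) ⟩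
        2 ^ f * 2 ^ f * (1 + P * 2) ^ K * suc P ^ D
          ≡⟨ cong (λ e → e * (1 + P * 2) ^ K * suc P ^ D) (sym (^-distribˡ-+-* 2 f f)) ⟩
        -- The mean of a factor is 2 times 1 - 1/(2P + 2), and `hK` makes the number of pairs large
        -- enough to gain `2 ^ (f + f)`.
        2 ^ (f + f) * (1 + P * 2) ^ K * suc P ^ D
          ≤⟨ *-monoˡ-≤ (suc P ^ D) (2^*P^≤ (1 + P * 2) (f + f) K hK) ⟩
        suc (1 + P * 2) ^ K * suc P ^ D
          ≡⟨ cong (_* suc P ^ D) (^-distribʳ-* (suc P) 2 K) ⟩
        suc P ^ K * 2 ^ K * suc P ^ D ∎
    }
    where
    shuffle : ∀ a b c → a * (b * c) ≡ b * (a * c)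
    shuffle = solve-∀
    shuffle′ : ∀ a b c d → 4 * (a * (b * (c * d))) ≡ 4 * a * (b * c * d)
    shuffle′ = solve-∀
    shuffle″ : ∀ a b c → a * (a * b * c) ≡ a * a * b * c
    shuffle″ = solve-∀
  rareB : Rare {suc P} {D} (λ (c , S) → Spread δ φ S) (cartesianProduct (allFin r) (vecs n k))
    (λ (c , S) ω → Π (pairs k) (weight φ S c δ (absent ω))) (2 ^ (δ * K + δ * f))
  rareB = record
    { dec = λ (c , S) → Fin.all? λ a → _ <? _
    ; q = 1
    ; M = (2 ^ δ) ^ K * suc P ^ D
    ; q-pos = ≤-refl
    ; θ-pos = m^n>0 2 (δ * K + δ * f)
    ; mean = λ (c , S) _ → ≤-trans (≤-reflexive (*-identityˡ _)) (E-weight φ S c P δ hδ)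
    ; small = begin
        4 * (length (cartesianProduct (allFin r) (vecs n k)) * ((2 ^ δ) ^ K * suc P ^ D))
          ≡⟨ cong (λ l → 4 * (l * ((2 ^ δ) ^ K * suc P ^ D))) (length-colours×vecs r n k) ⟩
        4 * (r * n ^ k * ((2 ^ δ) ^ K * suc P ^ D))
          ≡⟨ shuffle (r * n ^ k) ((2 ^ δ) ^ K) (suc P ^ D) ⟩
        (2 ^ δ) ^ K * (4 * (r * n ^ k)) * suc P ^ D
          ≤⟨ *-monoˡ-≤ (suc P ^ D) (*-monoʳ-≤ ((2 ^ δ) ^ K) hB) ⟩
        (2 ^ δ) ^ K * 2 ^ (δ * f) * suc P ^ D
          ≡⟨ cong (λ e → e * 2 ^ (δ * f) * suc P ^ D) (^-*-assoc 2 δ K) ⟩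
        2 ^ (δ * K) * 2 ^ (δ * f) * suc P ^ D
          ≡⟨ cong (_* suc P ^ D) (trans (sym (^-distribˡ-+-* 2 (δ * K) (δ * f))) (sym (*-identityˡ _))) ⟩
        1 * 2 ^ (δ * K + δ * f) * suc P ^ D ∎
    }
    where
    shuffle : ∀ a b c → 4 * (a * (b * c)) ≡ b * (4 * a) * c
    shuffle = solve-∀

-- The colouring and its monochromatic cliques

-- Reduces a set to its first `s` colours, as a colouring needs exactly `s` on each edge; removing
-- colours creates no monochromatic clique.
trim : ℕ → Subset r → Subset r
trim zero p = Subset.⊥
trim (suc s) [] = []
trim (suc s) (true ∷ p) = true ∷ trim s p
trim (suc s) (false ∷ p) = false ∷ trim (suc s) p

∣trim∣ : ∀ s (p : Subset r) → s ≤ ∣ p ∣ → ∣ trim s p ∣ ≡ s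
∣trim∣ {r} zero p _ = Subset.∣⊥∣≡0 r
∣trim∣ (suc s) [] ()
∣trim∣ (suc s) (true ∷ p) (s≤s h) = cong suc (∣trim∣ s p h)
∣trim∣ (suc s) (false ∷ p) h = ∣trim∣ (suc s) p h

trim⊆ : ∀ s (p : Subset r) {x} → x ∈ₛ trim s p → x ∈ₛ p
trim⊆ zero p x∈ = contradiction x∈ Subset.∉⊥
trim⊆ (suc s) (true ∷ p) Vec.here = Vec.here
trim⊆ (suc s) (true ∷ p) (Vec.there x∈) = Vec.there (trim⊆ s p x∈)
trim⊆ (suc s) (false ∷ p) (Vec.there x∈) = Vec.there (trim⊆ (suc s) p x∈)

∈-tabulate⁻ : (f : Fin r → Bool) {x : Fin r} → x ∈ₛ Vec.tabulate f → f x ≡ true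
∈-tabulate⁻ f {x} x∈ = trans (sym (lookup∘tabulate f x)) ([]=⇒lookup x∈)

elements : ∀ {k} (S : Subset n) → ∣ S ∣ ≡ k → ∃ λ (T : Vec (Fin n) k) → Unique T × (∀ w → w Vec.∈ T → w ∈ₛ S)
elements [] refl = [] , [] , λ _ ()
elements (b ∷ S) eq with elements S refl
... | T , uT , T⊆S with b
...   | true with refl ← eq = zero ∷ Vec.map suc T
        , VecAll.map⁺ (VecAll.universal (λ _ ()) T) ∷ Unique.map⁺ Fin.suc-injective uT
        , λ { _ (here refl) → Vec.here
            ; _ (there i) → let x , x∈ , e = fromAny (VecAny.map⁻ i) in subst (_∈ₛ (true ∷ S)) (sym e) (Vec.there (T⊆S x x∈)) }
...   | false with refl ← eq = Vec.map suc T , Unique.map⁺ Fin.suc-injective uT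
        , λ _ i → let x , x∈ , e = fromAny (VecAny.map⁻ i) in subst (_∈ₛ (false ∷ S)) (sym e) (Vec.there (T⊆S x x∈))

==-comm : (x y : Fin m) → x == y ≡ y == x
==-comm x y with x Fin.≟ y
... | yes refl = sym (≡⇒== {x = x} refl)
... | no ne = sym (≢⇒== (ne ∘ sym))

count-none : (p : X → Bool) (xs : List X) → All (λ x → p x ≡ false) xs → count p xs ≡ 0
count-none p [] [] = refl
count-none p (x ∷ xs) (e ∷ es) rewrite e = count-none p xs es

count-== : (c : Fin r) (xs : List (Fin r)) → List.Unique xs → count (_== c) xs ≤ 1
count-== c [] [] = z≤n
count-== c (x ∷ xs) (x∉xs ∷ u) with x == c in eq
... | false = count-== c xs u
... | true = s≤s (≤-reflexive (count-none (_== c) xs (All.map (λ x≢y → ≢⇒== λ y≡c → x≢y (trans (==⇒≡ eq) (sym y≡c))) x∉xs)))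

-- A pair that would miss too many colours gets back those in which its images are distinct non-edges.
-- Colours in which its images coincide are never given back, so φ · c is injective on every clique of colour c.
module Colouring (s : ℕ) (φ : Fin n → Fin r → Fin m) (g : Fin r → Fin m × Fin m → Bool) where

  apart : Fin n → Fin n → Fin r → Bool
  apart u v j = not (φ u j == φ v j)

  adjacent : Fin n → Fin n → Fin r → Bool
  adjacent u v j = apart u v j ∧ not (g j (φ u j , φ v j))

  available : Fin n → Fin n → Subset r
  available u v with s ≤? ∣ Vec.tabulate (adjacent u v) ∣
  ... | yes _ = Vec.tabulate (adjacent u v)
  ... | no _ = Vec.tabulate (apart u v)

  available-sym : (∀ j x y → g j (x , y) ≡ g j (y , x)) → ∀ u v → available u v ≡ available v u
  available-sym g-sym u v = trans (unfold u v) (trans (cong₂ (λ A B → select (s ≤? ∣ A ∣) A B) adj ap) (sym (unfold v u)))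
    where
    select : {P : Set} → Dec P → Subset r → Subset r → Subset r
    select (yes _) A B = A
    select (no _) A B = B
    unfold : ∀ u v →
      available u v ≡ select (s ≤? ∣ Vec.tabulate (adjacent u v) ∣) (Vec.tabulate (adjacent u v)) (Vec.tabulate (apart u v))
    unfold u v with s ≤? ∣ Vec.tabulate (adjacent u v) ∣
    ... | yes _ = refl
    ... | no _ = refl
    ap : Vec.tabulate (apart u v) ≡ Vec.tabulate (apart v u)
    ap = tabulate-cong λ j → cong not (==-comm (φ u j) (φ v j))
    adj : Vec.tabulate (adjacent u v) ≡ Vec.tabulate (adjacent v u)
    adj = tabulate-cong λ j → cong₂ (λ a b → not a ∧ not b) (==-comm (φ u j) (φ v j)) (g-sym j (φ u j) (φ v j))

  available-apart : ∀ u v {c} → c ∈ₛ available u v → apart u v c ≡ true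
  available-apart u v {c} c∈ with s ≤? ∣ Vec.tabulate (adjacent u v) ∣
  ... | yes _ = ∧-conicalˡ (apart u v c) _ (∈-tabulate⁻ (adjacent u v) c∈)
  ... | no _ = ∈-tabulate⁻ (apart u v) c∈

  -- A colour in which the images form a non-edge is available only in the fallback case, which
  -- means that the pair is bad.
  available-non-edge : ∀ u v {c} → c ∈ₛ available u v → g c (φ u c , φ v c) ≡ true →
    count (adjacent u v) (allFin r) < s
  available-non-edge u v {c} c∈ gc with s ≤? ∣ Vec.tabulate (adjacent u v) ∣
  ... | no ≰ = subst (_< s) (∣tabulate∣ (adjacent u v)) (≰⇒> ≰)
  ... | yes _ with eq ← ∈-tabulate⁻ (adjacent u v) c∈ rewrite gc with () ← trans (sym (∧-zeroʳ (apart u v c))) eq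

  agree : Fin n → Fin n → Fin r → Bool
  agree u v j = φ u j == φ v j

  available-size : ∀ {d} u v → s + d ≡ r → count (agree u v) (allFin r) ≤ d → s ≤ ∣ available u v ∣
  available-size {d} u v s+d≡r few with s ≤? ∣ Vec.tabulate (adjacent u v) ∣
  ... | yes s≤ = s≤
  ... | no _ = +-cancelʳ-≤ d _ _ (begin
    s + d                                                    ≡⟨ s+d≡r ⟩
    r
      ≡⟨ sym (trans (count-not (agree u v) (allFin r)) (length-allFin r)) ⟩
    count (agree u v) (allFin r) + count (apart u v) (allFin r) ≤⟨ +-monoˡ-≤ _ few ⟩
    d + count (apart u v) (allFin r)                         ≡⟨ +-comm d _ ⟩
    count (apart u v) (allFin r) + d
      ≡⟨ cong (_+ d) (sym (∣tabulate∣ (apart u v))) ⟩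
    ∣ Vec.tabulate (apart u v) ∣ + d                         ∎)
    where open ≤-Reasoning

  -- A bad pair misses more than `d` colours. Coincidence of the two images accounts for at most `δ`
  -- of them, sharing for at most `δ` at each entry, and `c` for one; since `5 * δ ≤ d`, at least
  -- `δ + δ` live non-edges remain.
  many-live : ∀ {d δ p} → s + d ≡ r → 5 * δ ≤ d → (S : Vec (Fin n) p) (c : Fin r) → Spread δ φ S →
    ∀ a b → count (agree (lookup S a) (lookup S b)) (allFin r) < δ →
    count (adjacent (lookup S a) (lookup S b)) (allFin r) < s →
    δ + δ ≤ count (λ j → live φ S c (a , b) j ∧ g j (image φ S c j (a , b))) (allFin r)
  many-live {d} {δ} s+d≡r 5δ≤d S c spread a b few lt =
    +-cancelˡ-≤ (3 * δ + d) _ _ (begin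
      3 * δ + d + (δ + δ)          ≡⟨ shuffle δ d ⟩
      5 * δ + d                    ≤⟨ +-monoˡ-≤ d 5δ≤d ⟩
      -- The strictness of `d<missing` pays for the colour `c`.
      d + d                        ≤⟨ +-monoʳ-≤ d (≤-pred (≤-trans d<missing missing≤)) ⟩
      d + (3 * δ + live#)          ≡⟨ shuffle′ d (3 * δ) live# ⟩
      3 * δ + d + live#            ∎)
    where
    open ≤-Reasoning
    u = lookup S a
    v = lookup S b
    All-r = allFin r
    hot : Fin r → Bool
    hot j = live φ S c (a , b) j ∧ g j (image φ S c j (a , b))
    live# = count hot All-r
    missing# = count (not ∘ adjacent u v) All-r
    cover : ∀ j → not (adjacent u v j) ≡ true →
      (agree u v j ∨ (shared φ S a j ∨ (shared φ S b j ∨ (j == c ∨ hot j)))) ≡ true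
    cover j e with φ u j == φ v j | shared φ S a j | shared φ S b j | j == c | g j (φ u j , φ v j)
    ... | true | _ | _ | _ | _ = refl
    ... | false | true | _ | _ | _ = refl
    ... | false | false | true | _ | _ = refl
    ... | false | false | false | true | _ = refl
    ... | false | false | false | false | true = refl
    d<missing : suc d ≤ missing#
    d<missing = +-cancelˡ-≤ s _ _ (begin
      s + suc d                                  ≡⟨ +-suc s d ⟩
      suc (s + d)
        ≡⟨ cong suc (trans s+d≡r (sym (trans (count-not (adjacent u v) All-r) (length-allFin r)))) ⟩
      suc (count (adjacent u v) All-r) + missing# ≤⟨ +-monoˡ-≤ missing# lt ⟩
      s + missing#                               ∎)
    missing≤ : missing# ≤ suc (3 * δ + live#)
    missing≤ = begin
      missing# ≤⟨ count-mono All-r cover ⟩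
      count (λ j → agree u v j ∨ (shared φ S a j ∨ (shared φ S b j ∨ (j == c ∨ hot j)))) All-r
        ≤⟨ count-∨ (agree u v) _ All-r ⟩
      _ ≤⟨ +-mono-≤ (<⇒≤ few) (count-∨ (shared φ S a) _ All-r) ⟩
      _ ≤⟨ +-monoʳ-≤ δ (+-mono-≤ (<⇒≤ (spread a)) (count-∨ (shared φ S b) _ All-r)) ⟩
      _ ≤⟨ +-monoʳ-≤ δ (+-monoʳ-≤ δ (+-mono-≤ (<⇒≤ (spread b)) (count-∨ (_== c) hot All-r))) ⟩
      _
        ≤⟨ +-monoʳ-≤ δ (+-monoʳ-≤ δ (+-monoʳ-≤ δ (+-monoˡ-≤ live# (count-== c All-r (allFin⁺ r))))) ⟩
      δ + (δ + (δ + (1 + live#))) ≡⟨ shuffle″ δ live# ⟩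
      suc (3 * δ + live#) ∎
      where
      shuffle″ : ∀ a b → a + (a + (a + (1 + b))) ≡ 1 + (3 * a + b)
      shuffle″ = solve-∀
    shuffle : ∀ a d → 3 * a + d + (a + a) ≡ 5 * a + d
    shuffle = solve-∀
    shuffle′ : ∀ a b c → a + (b + c) ≡ b + a + c
    shuffle′ = solve-∀

  -- On a clique of colour `c` the map of colour `c` is injective, so `dense` yields more than `f`
  -- non-edges. Each of them is a bad pair and weighs at least `2 ^ (δ + δ)`, every other pair
  -- weighs `2 ^ δ`, and the product contradicts `light`.
  clique-free : ∀ {d δ f k} → s + d ≡ r → 5 * δ ≤ d →
    (∀ u v → u ≢ v → count (agree u v) (allFin r) < δ) →
    (∀ c (T : Vec (Fin m) k) → Unique T → f < count (λ e → g c (lookup₂ T e)) (pairs k)) →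
    (∀ c (S : Vec (Fin n) k) → Spread δ φ S → Π (pairs k) (weight φ S c δ g) < 2 ^ (δ * length (pairs k) + δ * f)) →
    ∀ c (S : Vec (Fin n) k) → Unique S → Spread δ φ S →
    ¬ (∀ a b → a ≢ b → c ∈ₛ available (lookup S a) (lookup S b))
  clique-free {d} {δ} {f} {k} s+d≡r 5δ≤d few dense light c S uS spread mono =
    <⇒≱ (light c S spread) (begin
      2 ^ (δ * K + δ * f)
        ≤⟨ ^-monoʳ-≤ 2 (+-monoʳ-≤ (δ * K) (*-monoʳ-≤ δ (<⇒≤ f<non-edges))) ⟩
      2 ^ (δ * K + δ * count non-edge (pairs k))
        ≤⟨ Π-lower δ non-edge (weight φ S c δ g) (pairs k) (All.map (λ {e} → heavy e) (pairs-ordered k)) ⟩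
      Π (pairs k) (weight φ S c δ g) ∎)
    where
    open ≤-Reasoning
    K = length (pairs k)
    non-edge : Fin k × Fin k → Bool
    non-edge e = g c (image φ S c c e)
    T : Vec (Fin m) k
    T = Vec.tabulate λ a → φ (lookup S a) c
    uT : Unique T
    uT = Unique.tabulate⁺ λ {a} {b} e → decidable-stable (a Fin.≟ b) λ a≢b →
      case-absurd (trans (sym (cong not (≡⇒== e))) (available-apart (lookup S a) (lookup S b) (mono a b a≢b)))
      where
      case-absurd : false ≢ true
      case-absurd ()
    f<non-edges : f < count non-edge (pairs k)
    f<non-edges = subst (f <_) (count-cong (pairs k) λ (a , b) →
      cong₂ (λ x y → g c (x , y)) (lookup∘tabulate (λ a → φ (lookup S a) c) a) (lookup∘tabulate (λ a → φ (lookup S a) c) b)) (dense c T uT)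
    heavy : ∀ e → proj₁ e ≢ proj₂ e → 2 ^ (δ + (if non-edge e then δ else 0)) ≤ weight φ S c δ g e
    heavy (a , b) a≢b with g c (φ (lookup S a) c , φ (lookup S b) c) in eq
    ... | false = ≤-reflexive (cong (2 ^_) (+-identityʳ δ))
    ... | true = ^-monoʳ-≤ 2 (many-live s+d≡r 5δ≤d S c spread a b
      (few _ _ (a≢b ∘ Unique.lookup-injective uS a b))
      (available-non-edge (lookup S a) (lookup S b) (mono a b a≢b) eq))

  module _ {d δ : ℕ} (g-sym : ∀ j x y → g j (x , y) ≡ g j (y , x)) (s+d≡r : s + d ≡ r) (5δ≤d : 5 * δ ≤ d)
    (few : ∀ u v → u ≢ v → count (agree u v) (allFin r) < δ) where

    χ : SetColouring r s n
    χ = (λ u v → trim s (available u v))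
      , (λ u v → cong (trim s) (available-sym g-sym u v))
      , (λ u v u≢v → ∣trim∣ s (available u v) (available-size u v s+d≡r
          (≤-trans (<⇒≤ (few u v u≢v)) (≤-trans (m≤n*m δ 5) 5δ≤d))))

    -- Fewer than `k′ * δ` collisions among at least `k′ + k′` clique vertices leave a spread
    -- subtuple of size `k′`, to which `clique-free` applies.
    χ-clique-free : ∀ {f k k′} → 1 ≤ δ → k′ + k′ ≤ k →
      (∀ (S : Vec (Fin n) k) → Unique S → collisions φ S < k′ * δ) →
      (∀ c (T : Vec (Fin m) k′) → Unique T → f < count (λ e → g c (lookup₂ T e)) (pairs k′)) →
      (∀ c (S : Vec (Fin n) k′) → Spread δ φ S → Π (pairs k′) (weight φ S c δ g) < 2 ^ (δ * length (pairs k′) + δ * f)) →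
      ¬ HasMonoClique k χ
    χ-clique-free {f} {k} {k′} δ≥1 2k′≤k few-k dense light (S , c , ∣S∣≡k , mono) =
      let T , uT , T⊆S = elements S ∣S∣≡k
          U , uU , U⊆T , spread = spread-subtuple δ≥1 φ T uT k′ (bound T uT)
          in-S : ∀ a → lookup U a ∈ₛ S
          in-S a = T⊆S _ (U⊆T _ (∈-lookup a U))
      in clique-free {d} {δ} {f} {k′} s+d≡r 5δ≤d few dense light c U uU spread
           λ a b a≢b → trim⊆ s _ (mono _ _ (in-S a) (in-S b) (a≢b ∘ Unique.lookup-injective uU a b))
      where
      open ≤-Reasoning
      bound : ∀ T → Unique T → collisions φ T + k′ * δ ≤ k * δ
      bound T uT = begin
        collisions φ T + k′ * δ ≤⟨ +-monoˡ-≤ (k′ * δ) (<⇒≤ (few-k T uT)) ⟩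
        k′ * δ + k′ * δ         ≡⟨ sym (*-distribʳ-+ δ k′ k′) ⟩
        (k′ + k′) * δ           ≤⟨ *-monoˡ-≤ δ 2k′≤k ⟩
        k * δ                   ∎

-- The construction under numerical conditions

¬ramsey : ∀ {n r s d k k′ δ f P y m} .{{_ : NonZero r}} .{{_ : NonZero y}} →
  s + d ≡ r → 1 ≤ δ → 5 * δ ≤ d → 2 ≤ k → k′ + k′ ≤ k →
  1 ≤ m → 2 * r * (k * y) ≤ m → n ^ k * 2 ^ k * 4 ≤ y ^ (k′ * δ) → n ^ 2 * 16 ≤ y ^ δ →
  suc (suc P) ^ r ≤ 2 ^ δ * suc P ^ r → (1 + P * 2) * (f + f) ≤ length (pairs k′) →
  4 * (r * m ^ k′) ≤ 2 ^ f → 4 * (r * n ^ k′) ≤ 2 ^ (δ * f) →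
  ¬ RamseyProperty r s k n
¬ramsey {n} {r} {s} {d} {k} {k′} {δ} {f} {P} {y} {m} s+d≡r δ≥1 5δ≤d k≥2 2k′≤k m≥1 hm hL hδ hP hK hA hB ramsey =
  let φ , few-k , few-2 = few-collisions {r} {m} {n} {y} {k} {k′ * δ} {δ} m≥1 hm k≥2 hL hδ
      g , g-sym , dense , light = random-graphs {n} {r} {m} {f} {δ} {k′} {P} φ hP hK hA hB
      open Colouring s φ g
      few : ∀ u v → u ≢ v → count (agree u v) (allFin r) < δ
      -- The collisions of a tuple with two entries are the colours in which these agree.
      few u v u≢v = ≤-<-trans (≤-trans (count-mono (allFin r) λ j e → cong (_∨ false) e) (m≤m+n _ _))
        (few-2 (u ∷ v ∷ []) ((u≢v ∷ []) ∷ [] ∷ []))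
  in χ-clique-free {d} {δ} g-sym s+d≡r 5δ≤d few {f} {k} {k′} δ≥1 2k′≤k few-k dense light
       (ramsey (χ {d} {δ} g-sym s+d≡r 5δ≤d few))

-- Roots, rounding and growth

^-cancelˡ-≤ : ∀ {a b} e .{{_ : NonZero e}} → a ^ e ≤ b ^ e → a ≤ b
^-cancelˡ-≤ {a} {b} e h = ≮⇒≥ λ b<a → <⇒≱ (^-monoˡ-< e b<a) h

^-cancelˡ-< : ∀ {a b} e → a ^ e < b ^ e → a < b
^-cancelˡ-< e h = ≰⇒> λ b≤a → <⇒≱ h (^-monoˡ-≤ e b≤a)

^-cancelʳ-≤ : ∀ {a b} → 2 ^ a ≤ 2 ^ b → a ≤ b
^-cancelʳ-≤ h = ≮⇒≥ λ b<a → <⇒≱ (^-monoʳ-< 2 (s≤s (s≤s z≤n)) b<a) h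

-- The base may be 0, as the number of vertices may be; hence the condition `1 ≤ a`.
^-monoʳ-≤′ : ∀ x {a b} → 1 ≤ a → a ≤ b → x ^ a ≤ x ^ b
^-monoʳ-≤′ zero {suc a} _ _ = z≤n
^-monoʳ-≤′ (suc x) _ a≤b = ^-monoʳ-≤ (suc x) a≤b

square-cancel-≤ : ∀ {a b} → a * a ≤ b * b → a ≤ b
square-cancel-≤ h = ≮⇒≥ λ b<a → <⇒≱ (*-mono-< b<a b<a) h

-- Raising the exponent by one doubles the right side, while the square at most doubles from 3 on;
-- hence the offset 3.
exp-beats-square : ∀ c j t → (c * (t + 3)) * (c * (t + 3)) ≤ 2 ^ (t + 3) →
  (c * (j + t + 3)) * (c * (j + t + 3)) ≤ 2 ^ (j + t + 3)
exp-beats-square c zero t h = h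
exp-beats-square c (suc j) t h = begin
  c * suc (j + t + 3) * (c * suc (j + t + 3))  ≤⟨ lemma (j + t) ⟩
  2 * (c * (j + t + 3) * (c * (j + t + 3)))    ≤⟨ *-monoʳ-≤ 2 (exp-beats-square c j t h) ⟩
  2 * 2 ^ (j + t + 3)                          ∎
  where
  open ≤-Reasoning
  shuffle : ∀ c x →
    2 * (c * (x + 3) * (c * (x + 3))) ≡ c * (1 + (x + 3)) * (c * (1 + (x + 3))) + c * c * (x * x + 4 * x + 2)
  shuffle = solve-∀
  lemma : ∀ x → c * suc (x + 3) * (c * suc (x + 3)) ≤ 2 * (c * (x + 3) * (c * (x + 3)))
  lemma x = ≤-trans (m≤m+n _ _) (≤-reflexive (sym (shuffle c x)))

-- The factor is 1536, from the bound on 2rk by 1536ηr² that it serves. The base case at `61 + 3`,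
-- that is 64, is a computation on numerals.
exp-beats-square-at-64 : ∀ {η} → 64 ≤ η → 2 * (3 * (2 * 64)) * 2 * η * (2 * (3 * (2 * 64)) * 2 * η) ≤ 2 ^ η
exp-beats-square-at-64 {η} 64≤η = subst (λ e → c * e * (c * e) ≤ 2 ^ e) eq
  (exp-beats-square c (η ∸ 64) 61 (≤ᵇ⇒≤ (c * 64 * (c * 64)) (2 ^ 64) tt))
  where
  c = 2 * (3 * (2 * 64)) * 2
  eq : η ∸ 64 + 61 + 3 ≡ η
  eq = trans (+-assoc (η ∸ 64) 61 3) (m∸n+n≡m 64≤η)

m<[1+m/n]*n : ∀ m n .{{_ : NonZero n}} → m < suc (m / n) * n
m<[1+m/n]*n m n = subst (_< n + m / n * n) (sym (m≡m%n+[m/n]*n m n)) (+-monoˡ-< (m / n * n) (m%n<n m n))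

suc-≤-double : ∀ {x} → 1 ≤ x → suc x ≤ 2 * x
suc-≤-double {x} 1≤x = ≤-trans (+-monoˡ-≤ x 1≤x) (≤-reflexive (cong (x +_) (sym (+-identityʳ x))))

-- Rounding a quotient down costs at most a factor of 2 once the quotient is at least 1.
/-double : ∀ m n .{{_ : NonZero n}} → n ≤ m → 1 ≤ m / n × m < 2 * (m / n) * n
/-double m n n≤m = 1≤ , ≤-trans (m<[1+m/n]*n m n) (*-monoˡ-≤ n (suc-≤-double 1≤))
  where
  1≤ : 1 ≤ m / n
  1≤ = ≤-pred (*-cancelʳ-< n 1 (suc (m / n)) (≤-<-trans (≤-trans (≤-reflexive (*-identityˡ n)) n≤m) (m<[1+m/n]*n m n)))

-- Choice of parameters

-- The random graphs have 2^(2η) vertices and non-edge density 1/(2(q + 1));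
-- f = 4ηk′ is the number of non-edges guaranteed among k′ = ⌊k/2⌋ vertices.
ramsey-bound : ∀ {n r s d k δ q η} .{{_ : NonZero r}} → s + d ≡ r → 1 ≤ δ → 5 * δ ≤ d → 2 ≤ k →
  r ≤ suc q * δ →
  64 * suc q * η ≤ pred (k / 2) → 1 ≤ k / 2 → 24 ≤ η → 2 * r * k ≤ 2 ^ η → n ^ 6 ≤ 2 ^ (η * δ) →
  ¬ RamseyProperty r s k n
ramsey-bound {n} {r} {s} {d} {k} {δ} {q} {η} s+d≡r δ≥1 5δ≤d k≥2 r≤qδ hη k′≥1 η≥24 2rk≤y n^6≤ =
  ¬ramsey {n} {r} {s} {d} {k} {k′} {δ} {f} {P} {y} {2 ^ (η + η)} s+d≡r δ≥1 5δ≤d k≥2 2k′≤k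
    (m^n>0 2 (η + η)) hm hL hδ (suc-2q^r≤ (suc q) δ r r≤qδ) hK hA hB
  where
  open ≤-Reasoning
  k′ = k / 2
  y = 2 ^ η
  f = 4 * η * k′
  -- `suc P` computes to `2 * suc q`, the base in `suc-2q^r≤`.
  P = q + suc (q + 0)
  instance
    _ = m^n≢0 2 η
  2k′≤k : k′ + k′ ≤ k
  2k′≤k = ≤-trans (≤-reflexive (trans (cong (k′ +_) (sym (+-identityʳ k′))) (*-comm 2 k′))) (m/n*n≤m k 2)
  k≤3k′ : k ≤ 3 * k′
  k≤3k′ = begin
    k             ≤⟨ ≤-pred (m<[1+m/n]*n k 2) ⟩
    1 + k′ * 2    ≤⟨ +-monoˡ-≤ (k′ * 2) k′≥1 ⟩
    k′ + k′ * 2   ≡⟨ cong (k′ +_) (*-comm k′ 2) ⟩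
    3 * k′        ∎
  hm : 2 * r * (k * y) ≤ 2 ^ (η + η)
  hm = begin
    2 * r * (k * y)   ≡⟨ sym (*-assoc (2 * r) k y) ⟩
    2 * r * k * y     ≤⟨ *-monoˡ-≤ y 2rk≤y ⟩
    2 ^ η * 2 ^ η     ≡⟨ sym (^-distribˡ-+-* 2 η η) ⟩
    2 ^ (η + η)       ∎
  -- The 16 absorbs the constant factors in the bounds on `n`, and the cube comes from `k ≤ 3 * k′`.
  -- Since `16 ^ 6` is `2 ^ 24`, it is harmless for `η ≥ 24`.
  x = 16 * n
  x³≤ : x ^ 3 ≤ 2 ^ (η * δ)
  x³≤ = square-cancel-≤ (begin
    x ^ 3 * x ^ 3              ≡⟨ sym (^-distribˡ-+-* x 3 3) ⟩
    x ^ 6                      ≡⟨ ^-distribʳ-* 16 n 6 ⟩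
    2 ^ 24 * n ^ 6
      ≤⟨ *-mono-≤ (^-monoʳ-≤ 2 (≤-trans η≥24 (m≤m*n η δ {{>-nonZero δ≥1}}))) n^6≤ ⟩
    2 ^ (η * δ) * 2 ^ (η * δ)  ∎)
  n≤x : n ≤ x
  n≤x = m≤n*m n 16
  y^ : ∀ e → (2 ^ (η * δ)) ^ e ≡ y ^ (e * δ)
  y^ e = trans (^-*-assoc 2 (η * δ) e) (trans (cong (2 ^_) (shuffle η δ e)) (sym (^-*-assoc 2 η (e * δ))))
    where
    shuffle : ∀ a b c → a * b * c ≡ a * (c * b)
    shuffle = solve-∀
  hL : n ^ k * 2 ^ k * 4 ≤ y ^ (k′ * δ)
  hL = begin
    n ^ k * 2 ^ k * 4
      ≤⟨ *-monoʳ-≤ (n ^ k * 2 ^ k) (≤-trans (≤ᵇ⇒≤ 4 8 tt) (^-monoʳ-≤ 8 {1} {k} (≤-trans (s≤s z≤n) k≥2))) ⟩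
    n ^ k * 2 ^ k * 8 ^ k
      ≡⟨ trans (cong (_* 8 ^ k) (sym (^-distribʳ-* n 2 k))) (sym (^-distribʳ-* (n * 2) 8 k)) ⟩
    (n * 2 * 8) ^ k         ≡⟨ cong (_^ k) (trans (*-assoc n 2 8) (*-comm n 16)) ⟩
    x ^ k                   ≤⟨ ^-monoʳ-≤′ x (≤-trans (s≤s z≤n) k≥2) k≤3k′ ⟩
    x ^ (3 * k′)            ≡⟨ sym (^-*-assoc x 3 k′) ⟩
    (x ^ 3) ^ k′            ≤⟨ ^-monoˡ-≤ k′ x³≤ ⟩
    (2 ^ (η * δ)) ^ k′      ≡⟨ y^ k′ ⟩
    y ^ (k′ * δ)            ∎
  hδ : n ^ 2 * 16 ≤ y ^ δ
  hδ = begin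
    n ^ 2 * 16        ≤⟨ *-monoʳ-≤ (n ^ 2) (≤ᵇ⇒≤ 16 256 tt) ⟩
    n ^ 2 * 16 ^ 2    ≡⟨ trans (sym (^-distribʳ-* n 16 2)) (cong (_^ 2) (*-comm n 16)) ⟩
    x ^ 2             ≤⟨ ^-monoʳ-≤′ x {2} {3} (s≤s z≤n) (s≤s (s≤s z≤n)) ⟩
    x ^ 3             ≤⟨ x³≤ ⟩
    2 ^ (η * δ)       ≡⟨ sym (^-*-assoc 2 η δ) ⟩
    y ^ δ             ∎
  hK : (1 + P * 2) * (f + f) ≤ length (pairs k′)
  hK = *-cancelˡ-≤ 2 (+-cancelʳ-≤ k′ _ _ (begin
    2 * ((1 + P * 2) * (f + f)) + k′
      ≤⟨ +-monoˡ-≤ k′ (*-monoʳ-≤ 2 (*-monoˡ-≤ (f + f) (n≤1+n (1 + P * 2)))) ⟩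
    -- Here 2 + 2P is 4(q + 1) and `f + f` is 8ηk′, which gives the constant 64; the summand `k′`
    -- turns `pred k′` back into `k′`.
    2 * ((2 + P * 2) * (f + f)) + k′          ≡⟨ shuffle q η k′ ⟩
    (64 * suc q * η + 1) * k′                 ≤⟨ *-monoˡ-≤ k′ (+-monoˡ-≤ 1 hη) ⟩
    (pred k′ + 1) * k′
      ≡⟨ cong (_* k′) (trans (+-comm (pred k′) 1) (suc-pred k′ {{>-nonZero k′≥1}})) ⟩
    k′ * k′                                   ≡⟨ sym (2*length-pairs k′) ⟩
    2 * length (pairs k′) + k′                ∎))
    where
    shuffle : ∀ q η k →
      2 * ((2 + (q + (1 + (q + 0))) * 2) * (4 * η * k + 4 * η * k)) + k ≡ (64 * (1 + q) * η + 1) * k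
    shuffle = solve-∀
  4r≤ : 4 * r ≤ 2 ^ (η * 2)
  4r≤ = begin
    4 * r           ≤⟨ *-mono-≤ {4} {2 ^ η} (^-monoʳ-≤ 2 {2} (≤-trans (s≤s (s≤s z≤n)) η≥24)) r≤y ⟩
    2 ^ η * 2 ^ η   ≡⟨ trans (sym (^-distribˡ-+-* 2 η η)) (cong (2 ^_) (shuffle η)) ⟩
    2 ^ (η * 2)     ∎
    where
    shuffle : ∀ a → a + a ≡ a * 2
    shuffle = solve-∀
    r≤y : r ≤ 2 ^ η
    r≤y = ≤-trans (≤-trans (m≤n*m r 2) (m≤m*n (2 * r) k {{>-nonZero (≤-trans (s≤s z≤n) k≥2)}})) 2rk≤y
  hA : 4 * (r * (2 ^ (η + η)) ^ k′) ≤ 2 ^ f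
  hA = begin
    -- Half of the exponent `f` absorbs `4 * r`, the other half is the exponent of the power of the
    -- number of points.
    4 * (r * (2 ^ (η + η)) ^ k′)      ≡⟨ sym (*-assoc 4 r _) ⟩
    4 * r * (2 ^ (η + η)) ^ k′
      ≤⟨ *-monoˡ-≤ _ (≤-trans 4r≤ (^-monoʳ-≤ 2 (m≤m*n (η * 2) k′ {{>-nonZero k′≥1}}))) ⟩
    2 ^ (η * 2 * k′) * (2 ^ (η + η)) ^ k′ ≡⟨ cong (2 ^ (η * 2 * k′) *_) (^-*-assoc 2 (η + η) k′) ⟩
    2 ^ (η * 2 * k′) * 2 ^ ((η + η) * k′) ≡⟨ sym (^-distribˡ-+-* 2 (η * 2 * k′) _) ⟩
    2 ^ (η * 2 * k′ + (η + η) * k′)   ≡⟨ cong (2 ^_) (shuffle η k′) ⟩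
    2 ^ f                             ∎
    where
    shuffle : ∀ a b → a * 2 * b + (a + a) * b ≡ 4 * a * b
    shuffle = solve-∀
  hB : 4 * (r * n ^ k′) ≤ 2 ^ (δ * f)
  hB = begin
    4 * (r * n ^ k′)                       ≡⟨ sym (*-assoc 4 r _) ⟩
    4 * r * n ^ k′
      ≤⟨ *-mono-≤ (≤-trans 4r≤ (^-monoʳ-≤ 2 (≤-trans (m≤m*n (η * 2) k′ {{>-nonZero k′≥1}}) (m≤m*n (η * 2 * k′) δ {{>-nonZero δ≥1}})))) (^-monoˡ-≤ k′ n≤) ⟩
    2 ^ (η * 2 * k′ * δ) * (2 ^ (η * δ)) ^ k′
      ≡⟨ cong (2 ^ (η * 2 * k′ * δ) *_) (^-*-assoc 2 (η * δ) k′) ⟩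
    2 ^ (η * 2 * k′ * δ) * 2 ^ (η * δ * k′) ≡⟨ sym (^-distribˡ-+-* 2 (η * 2 * k′ * δ) _) ⟩
    2 ^ (η * 2 * k′ * δ + η * δ * k′)
      ≤⟨ ^-monoʳ-≤ 2 (m≤m+n (η * 2 * k′ * δ + η * δ * k′) (η * δ * k′)) ⟩
    2 ^ (η * 2 * k′ * δ + η * δ * k′ + η * δ * k′) ≡⟨ cong (2 ^_) (shuffle η k′ δ) ⟩
    2 ^ (δ * f)                            ∎
    where
    n≤ : n ≤ 2 ^ (η * δ)
    n≤ = ≤-trans n≤x (≤-trans (≤-reflexive (sym (*-identityʳ x))) (≤-trans (^-monoʳ-≤′ x {1} {3} (s≤s z≤n) (s≤s z≤n)) x³≤))
    shuffle : ∀ a b c → a * 2 * b * c + a * c * b + a * c * b ≡ c * (4 * a * b)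
    shuffle = solve-∀

-- If the bound failed, `n` would be small enough for `ramsey-bound`. The constant is passed as a
-- variable with an equation so that exponents containing it stay symbolic.
ramsey-lower-bound : ∀ c → c ≡ 9216 → (r s k : ℕ) → 1 ≤ s → s < r →
  r ^ (64 * c) ≤ 2 ^ (1 * (r ∸ s)) →
  r ^ (64 * c * r) ≤ 2 ^ (1 * k * (r ∸ s)) →
  (n : ℕ) → RamseyProperty r s k n →
  2 ^ (1 * k * ((r ∸ s) * (r ∸ s))) ≤ n ^ (6 * (12 * c) * r)
ramsey-lower-bound c c≡ r s k s≥1 s<r hd hk n ramsey = ≮⇒≥ λ lt →
  ramsey-bound {n} {r} {s} {d} {k} {δ} {q} {η} (m+[n∸m]≡n (<⇒≤ s<r)) δ≥1 5δ≤d k≥2 r≤qδ hη k′≥1 (≤-trans (≤ᵇ⇒≤ 24 64 tt) η≥64) 2rk≤ (n^6≤ lt) ramsey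
  where
  open ≤-Reasoning
  d = r ∸ s
  r≥2 : 2 ≤ r
  r≥2 = ≤-trans (s≤s s≥1) s<r
  instance
    r≢0 : NonZero r
    r≢0 = >-nonZero (≤-trans (s≤s z≤n) r≥2)
    c≢0 : NonZero c
    c≢0 = subst NonZero (sym c≡) _
    cr≢0 : NonZero (c * r)
    cr≢0 = m*n≢0 c r
  a = 64 * c
  -- As `r ≥ 2`, the two logarithmic hypotheses give the plain bounds `a ≤ d` and `a * r ≤ k * d`.
  a≤d : a ≤ d
  a≤d = ^-cancelʳ-≤ {a} {d} (≤-trans (^-monoˡ-≤ a r≥2) (≤-trans hd (≤-reflexive (cong (2 ^_) (*-identityˡ d)))))
  ar≤kd : a * r ≤ k * d
  ar≤kd = ^-cancelʳ-≤ {a * r} {k * d} (≤-trans (^-monoˡ-≤ (a * r) r≥2) (≤-trans hk (≤-reflexive (cong (λ e → 2 ^ (e * d)) (*-identityˡ k)))))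
  7200≤a : 24 * 300 ≤ a
  7200≤a = subst (λ x → 24 * 300 ≤ 64 * x) (sym c≡) (≤ᵇ⇒≤ (24 * 300) (64 * 9216) tt)
  -- `δ` lies between d/12 and d/6, which leaves room for `5 * δ ≤ d`.
  δ = d / 6
  δ-facts = /-double d 6 (≤-trans (≤-trans (≤ᵇ⇒≤ 6 (24 * 300) tt) 7200≤a) a≤d)
  δ≥1 : 1 ≤ δ
  δ≥1 = proj₁ δ-facts
  d≤12δ : d ≤ 12 * δ
  d≤12δ = ≤-trans (<⇒≤ (proj₂ δ-facts)) (≤-reflexive (shuffle δ))
    where
    shuffle : ∀ a → 2 * a * 6 ≡ 12 * a
    shuffle = solve-∀
  5δ≤d : 5 * δ ≤ d
  5δ≤d = ≤-trans (*-monoˡ-≤ δ (≤ᵇ⇒≤ 5 6 tt)) (≤-trans (≤-reflexive (*-comm 6 δ)) (m/n*n≤m d 6))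
  instance
    δ≢0 : NonZero δ
    δ≢0 = >-nonZero δ≥1
  -- `suc q` lies between r/δ and 2r/δ, so the non-edge density is of order d/r.
  q = r / δ
  r≤qδ : r ≤ suc q * δ
  r≤qδ = <⇒≤ (m<[1+m/n]*n r δ)
  qδ≤2r : suc q * δ ≤ 2 * r
  qδ≤2r = begin
    δ + r / δ * δ  ≤⟨ +-mono-≤ (≤-trans (≤-trans (m≤n*m δ 5) 5δ≤d) (m∸n≤m r s)) (m/n*n≤m r δ) ⟩
    r + r          ≡⟨ cong (r +_) (sym (+-identityʳ r)) ⟩
    2 * r          ∎
  aq≤24k : a * suc q ≤ 24 * k
  aq≤24k = *-cancelʳ-≤ _ _ δ (begin
    a * suc q * δ       ≡⟨ *-assoc a (suc q) δ ⟩
    a * (suc q * δ)     ≤⟨ *-monoʳ-≤ a qδ≤2r ⟩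
    a * (2 * r)         ≡⟨ shuffle a r ⟩
    2 * (a * r)         ≤⟨ *-monoʳ-≤ 2 (≤-trans ar≤kd (*-monoʳ-≤ k d≤12δ)) ⟩
    2 * (k * (12 * δ))  ≡⟨ shuffle′ k δ ⟩
    24 * k * δ          ∎)
    where
    shuffle : ∀ a r → a * (2 * r) ≡ 2 * (a * r)
    shuffle = solve-∀
    shuffle′ : ∀ k d → 2 * (k * (12 * d)) ≡ 24 * k * d
    shuffle′ = solve-∀
  300q≤k : 300 * suc q ≤ k
  300q≤k = *-cancelˡ-≤ 24 (≤-trans (≤-reflexive (sym (*-assoc 24 300 (suc q)))) (≤-trans (*-monoˡ-≤ (suc q) 7200≤a) aq≤24k))
  k≥2 : 2 ≤ k
  k≥2 = ≤-trans (≤-trans (≤ᵇ⇒≤ 2 300 tt) (m≤m*n 300 (suc q))) 300q≤k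
  k′ = k / 2
  k<2k′+2 : k < suc k′ * 2
  k<2k′+2 = m<[1+m/n]*n k 2
  big-k′ : 65 * suc q ≤ k′
  big-k′ = ≤-pred (*-cancelʳ-< 2 _ _ (≤-<-trans (≤-trans (begin
    65 * suc q * 2  ≡⟨ *-comm (65 * suc q) 2 ⟩
    2 * (65 * suc q) ≡⟨ sym (*-assoc 2 65 (suc q)) ⟩
    2 * 65 * suc q  ≤⟨ *-monoˡ-≤ (suc q) (≤ᵇ⇒≤ (2 * 65) 300 tt) ⟩
    300 * suc q     ∎) 300q≤k) k<2k′+2))
  k′≥1 : 1 ≤ k′
  k′≥1 = ≤-trans (≤-trans (s≤s z≤n) (m≤m*n 65 (suc q))) big-k′
  instance
    k′≢0 : NonZero k′
    k′≢0 = >-nonZero k′≥1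
  64q≤ : 64 * suc q ≤ pred k′
  64q≤ = ≤-pred (≤-trans (≤-trans (+-monoˡ-≤ (64 * suc q) (s≤s z≤n)) big-k′) (≤-reflexive (sym (suc-pred k′))))
  η = pred k′ / (64 * suc q)
  η-facts = /-double (pred k′) (64 * suc q) 64q≤
  hη : 64 * suc q * η ≤ pred k′
  hη = ≤-trans (≤-reflexive (*-comm (64 * suc q) η)) (m/n*n≤m (pred k′) (64 * suc q))
  k′≤ : k′ ≤ 2 * 64 * (suc q * η)
  k′≤ = ≤-trans (≤-reflexive (sym (suc-pred k′))) (≤-trans (proj₂ η-facts) (≤-reflexive (shuffle η (suc q) 64)))
    where
    shuffle : ∀ a b x → 2 * a * (x * b) ≡ 2 * x * (b * a)
    shuffle = solve-∀
  k≤ : k ≤ 3 * (2 * 64) * (suc q * η)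
  k≤ = begin
    k                          ≤⟨ ≤-pred k<2k′+2 ⟩
    1 + k′ * 2                 ≤⟨ +-monoˡ-≤ (k′ * 2) k′≥1 ⟩
    k′ + k′ * 2                ≡⟨ cong (k′ +_) (*-comm k′ 2) ⟩
    3 * k′                     ≤⟨ *-monoʳ-≤ 3 k′≤ ⟩
    3 * (2 * 64 * (suc q * η)) ≡⟨ sym (*-assoc 3 (2 * 64) (suc q * η)) ⟩
    3 * (2 * 64) * (suc q * η) ∎
  kd≤ : k * d ≤ η * (c * r)
  kd≤ = begin
    k * d                              ≤⟨ *-mono-≤ k≤ d≤12δ ⟩
    3 * (2 * 64) * (suc q * η) * (12 * δ)  ≡⟨ shuffle (suc q) η δ (3 * (2 * 64)) 12 ⟩
    3 * (2 * 64) * 12 * η * (suc q * δ)    ≤⟨ *-monoʳ-≤ (3 * (2 * 64) * 12 * η) qδ≤2r ⟩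
    3 * (2 * 64) * 12 * η * (2 * r)        ≡⟨ shuffle′ η r (3 * (2 * 64) * 12) 2 ⟩
    -- The rounding losses for `k`, `d` and `q` multiply to 384 · 12 · 2 = 9216, the value of `c`.
    η * (3 * (2 * 64) * 12 * 2 * r)
      ≡⟨ cong (λ x → η * (x * r)) {3 * (2 * 64) * 12 * 2} {c} (sym c≡) ⟩
    η * (c * r)                        ∎
    where
    shuffle : ∀ q η δ x y → x * (q * η) * (y * δ) ≡ x * y * η * (q * δ)
    shuffle = solve-∀
    shuffle′ : ∀ η r x y → x * η * (y * r) ≡ η * (x * y * r)
    shuffle′ = solve-∀
  -- By `kd≤`, the hypothesis on `k` is at least as strong as the power of order `c * r` of this
  -- claim. The exponent 64 then gives `η ≥ 64` and dominates the `r ^ 4` needed for `2rk≤`.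
  r^64≤ : r ^ 64 ≤ 2 ^ η
  r^64≤ = ^-cancelˡ-≤ (c * r) (begin
    (r ^ 64) ^ (c * r)      ≡⟨ ^-*-assoc r 64 (c * r) ⟩
    r ^ (64 * (c * r))      ≡⟨ cong (r ^_) (sym (*-assoc 64 c r)) ⟩
    r ^ (64 * c * r)        ≤⟨ hk ⟩
    2 ^ (1 * k * d)
      ≤⟨ ^-monoʳ-≤ 2 (≤-trans (≤-reflexive (cong (_* d) (*-identityˡ k))) kd≤) ⟩
    2 ^ (η * (c * r))       ≡⟨ sym (^-*-assoc 2 η (c * r)) ⟩
    (2 ^ η) ^ (c * r)       ∎)
  η≥64 : 64 ≤ η
  η≥64 = ^-cancelʳ-≤ {64} {η} (≤-trans {2 ^ 64} {r ^ 64} {2 ^ η} (^-monoˡ-≤ 64 {2} {r} r≥2) r^64≤)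
  growth : 2 * (3 * (2 * 64)) * 2 * η * (2 * (3 * (2 * 64)) * 2 * η) ≤ 2 ^ η
  growth = exp-beats-square-at-64 η≥64
  -- The bound 1536ηr² is compared with `2 ^ η` after squaring: `growth` handles (1536η)² and
  -- `r^64≤` handles `r ^ 4`.
  2rk≤ : 2 * r * k ≤ 2 ^ η
  2rk≤ = ≤-trans 2rk≤′ (square-cancel-≤ (begin
    2 * (3 * (2 * 64)) * 2 * η * (r * r) * (2 * (3 * (2 * 64)) * 2 * η * (r * r))
      ≡⟨ shuffle (2 * (3 * (2 * 64)) * 2 * η) (r * r) ⟩
    2 * (3 * (2 * 64)) * 2 * η * (2 * (3 * (2 * 64)) * 2 * η) * (r * r * (r * r))
      ≤⟨ *-mono-≤ growth (≤-trans (≤-reflexive (r⁴ r)) (≤-trans (^-monoʳ-≤ r (≤ᵇ⇒≤ 4 64 tt)) r^64≤)) ⟩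
    2 ^ η * 2 ^ η                             ∎))
    where
    shuffle : ∀ a b → a * b * (a * b) ≡ a * a * (b * b)
    shuffle = solve-∀
    r⁴ : ∀ r → r * r * (r * r) ≡ r * (r * (r * (r * 1)))
    r⁴ = solve-∀
    shuffle′ : ∀ r q η x → 2 * r * (x * (q * η)) ≡ 2 * x * η * r * q
    shuffle′ = solve-∀
    shuffle″ : ∀ η r x → x * η * r * (2 * r) ≡ x * 2 * η * (r * r)
    shuffle″ = solve-∀
    2rk≤′ : 2 * r * k ≤ 2 * (3 * (2 * 64)) * 2 * η * (r * r)
    2rk≤′ = begin
      2 * r * k                    ≤⟨ *-monoʳ-≤ (2 * r) k≤ ⟩
      2 * r * (3 * (2 * 64) * (suc q * η))  ≡⟨ shuffle′ r (suc q) η (3 * (2 * 64)) ⟩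
      2 * (3 * (2 * 64)) * η * r * suc q
        ≤⟨ *-monoʳ-≤ (2 * (3 * (2 * 64)) * η * r) (≤-trans (m≤m*n (suc q) δ) qδ≤2r) ⟩
      2 * (3 * (2 * 64)) * η * r * (2 * r)  ≡⟨ shuffle″ η r (2 * (3 * (2 * 64))) ⟩
      2 * (3 * (2 * 64)) * 2 * η * (r * r)           ∎
  -- A root of order 12cr is taken, using kd ≤ ηcr and d ≤ 12δ; this fixes the exponent
  -- `6 * (12 * c) * r` of the conclusion.
  n^6≤ : n ^ (6 * (12 * c) * r) < 2 ^ (1 * k * (d * d)) → n ^ 6 ≤ 2 ^ (η * δ)
  n^6≤ lt = <⇒≤ (^-cancelˡ-< (12 * (c * r)) (begin-strict
    (n ^ 6) ^ (12 * (c * r))         ≡⟨ ^-*-assoc n 6 (12 * (c * r)) ⟩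
    n ^ (6 * (12 * (c * r)))         ≡⟨ cong (n ^_) (shuffle 6 12 c r) ⟩
    n ^ (6 * (12 * c) * r)           <⟨ lt ⟩
    2 ^ (1 * k * (d * d))            ≡⟨ cong (2 ^_) (shuffle′ k d) ⟩
    2 ^ (k * d * d)                  ≤⟨ ^-monoʳ-≤ 2 (*-mono-≤ kd≤ d≤12δ) ⟩
    2 ^ (η * (c * r) * (12 * δ))     ≡⟨ cong (2 ^_) (shuffle″ η (c * r) 12 δ) ⟩
    2 ^ (η * δ * (12 * (c * r)))     ≡⟨ sym (^-*-assoc 2 (η * δ) (12 * (c * r))) ⟩
    (2 ^ (η * δ)) ^ (12 * (c * r))   ∎))
    where
    shuffle : ∀ a b c r → a * (b * (c * r)) ≡ a * (b * c) * r
    shuffle = solve-∀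
    shuffle′ : ∀ k d → 1 * k * (d * d) ≡ k * d * d
    shuffle′ = solve-∀
    shuffle″ : ∀ a b c d → a * b * (c * d) ≡ a * d * (c * b)
    shuffle″ = solve-∀

-- Logarithms to base 2 are cleared into inequalities between powers: C is a/(b ln 2) and δ is (p ln
-- 2)/q. The bound holds for every `n` with the Ramsey property, in particular for the least one.
theorem1p1 : Σ ℕ λ a → Σ ℕ λ b → Σ ℕ λ p → Σ ℕ λ q →
    (1 ≤ a) × (1 ≤ b) × (1 ≤ p) × (1 ≤ q) ×
    ((r s k : ℕ) → 1 ≤ s → s < r →
    r ^ a ≤ 2 ^ (b * (r ∸ s)) →
    r ^ (a * r) ≤ 2 ^ (b * k * (r ∸ s)) →
    (n : ℕ) → RamseyProperty r s k n →
    2 ^ (p * k * ((r ∸ s) * (r ∸ s))) ≤ n ^ (q * r))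
theorem1p1 = 64 * 9216 , 1 , 1 , 6 * (12 * 9216) , s≤s z≤n , s≤s z≤n , s≤s z≤n , s≤s z≤n , ramsey-lower-bound 9216 refl
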